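{- $\displaystyle f\left(n,24,\binom{24}{2} - 15\right) = \Omega\left(n^{9/8}\right)$.
   Context: For positive integers $n,k,\ell$, $f(n,k,\ell)$ denotes the minimum size of a set of colors $C$ for which there exists a coloring $\chi:E(K_n)\to C$ of the edges of the complete graph $K_n$ such that every set of $k$ vertices of $K_n$ spans (in the induced subgraph $K_k$) edges of at least $\ell$ distinct colors. The asymptotic notation refers to $n\to\infty$. -}

module Defs where

open import Data.Nat using (ℕ)
open import Data.Fin using (Fin)
open import Data.Fin.Subset using (Subset; _∈_; ∣_∣)
open import Data.Product using (Σ; _×_; proj₁; proj₂)
open import Relation.Binary.PropositionalEquality using (_≡_; _≢_)
open import Function.Definitions using (Injective)

-- An edge colouring of K_n with colour set Fin m: a symmetric function on
-- ordered pairs of vertices (diagonal values are irrelevant).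
record Colouring (n m : ℕ) : Set where
  field
    χ   : Fin n → Fin n → Fin m
    sym : ∀ i j → χ i j ≡ χ j i
open Colouring public

AtLeastColours : {n m : ℕ} → Colouring n m → Subset n → ℕ → Set
AtLeastColours {n} c S ℓ =
  Σ (Fin ℓ → Fin n × Fin n) λ e →
    (∀ t → (proj₁ (e t) ∈ S) × (proj₂ (e t) ∈ S) × (proj₁ (e t) ≢ proj₂ (e t)))
    × Injective _≡_ _≡_ (λ t → χ c (proj₁ (e t)) (proj₂ (e t)))

Good : {n m : ℕ} → Colouring n m → ℕ → ℕ → Set
Good {n} c k ℓ = ∀ (S : Subset n) → ∣ S ∣ ≡ k → AtLeastColours c S ℓ

module Submission where

-- Call (a , b , c) and (a′ , b′ , c′) adjacent when aa′, bb′, cc′ are three distinct edges of the same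
-- colour. If m is small compared with n^(9/8), this graph on n³ triples has more than C (n³)^(5/4)
-- edges, hence a subgraph of minimum degree above C (n³)^(1/4). As in the Moore bound, some two triples
-- are then joined by many paths of length 4, so that the subgraph contains a cycle of length at most 8,
-- and together with a path attached to a shorter cycle always 8 triples spanning 8 adjacencies. These
-- involve at most 24 vertices, and 24 distinct edges with at most 8 colours, i.e. 16 repeated colours.
-- The edges are distinct because triples sharing a vertex are avoided: a colour has degree at most 16 at
-- a vertex, so only boundedly many neighbours of a triple meet any given triple. Splitting the vertices
-- into two halves and keeping only adjacencies between triples of different halves removes the need to
-- avoid the overlaps between middle triples of two paths, which are not bounded in this way.

open import Defs renaming (sym to χ-sym)
open import Algebra.Properties.CommutativeSemigroup using (x∙yz≈y∙xz; interchange)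
open import Data.Bool using (Bool; true; false; not)
import Data.Bool.Properties as Bool
open import Data.Empty using (⊥; ⊥-elim)
open import Data.Fin using (Fin; zero; suc; splitAt; _↑ˡ_; _↑ʳ_)
import Data.Fin.Properties as Fin
open import Data.Fin.Subset using (Subset; inside; outside; ∣_∣; _⊆_; _∪_; ⁅_⁆) renaming (_∈_ to _∈ₛ_; ⊥ to ∅)
open import Data.Fin.Subset.Properties using (s⊆s; ∣⊥∣≡0; x∈⁅x⁆; p⊆p∪q; q⊆p∪q; ∣⁅x⁆∣≡1)
open import Data.List using (List; []; _∷_; _++_; length; map; filter; concatMap; lookup; tabulate; cartesianProduct; allFin; take)
open import Data.List.Properties using (length-++; length-map; length-tabulate; length-take; filter-++)
open import Data.List.Membership.Propositional using (_∈_; _∉_; lose; find)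
open import Data.List.Membership.Propositional.Properties
import Data.List.Membership.DecPropositional as DecMembership
open import Data.List.Relation.Unary.All as All using (All; []; _∷_)
import Data.List.Relation.Unary.All.Properties as All
open import Data.List.Relation.Unary.AllPairs as AllPairs using (AllPairs; []; _∷_)
import Data.List.Relation.Unary.AllPairs.Properties as AllPairs
open import Data.List.Relation.Unary.Any as Any using (Any; here; there; index)
open import Data.List.Relation.Unary.Any.Properties using (lookup-index)
import Data.List.Relation.Unary.Unique.DecPropositional as DecUnique
open import Data.List.Relation.Unary.Unique.Propositional using (Unique)
import Data.List.Relation.Unary.Unique.Propositional.Properties as Unique
open import Data.Nat
open import Data.Nat.Combinatorics using (_C_)
open import Data.Nat.Properties
open import Data.Nat.Solver using (module +-*-Solver)
open import Data.Product using (Σ; Σ-syntax; ∃-syntax; ∃; _×_; _,_; proj₁; proj₂; swap)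
open import Data.Product.Properties using (≡-dec)
open import Data.Sum using (_⊎_; inj₁; inj₂; [_,_]′)
open import Data.Vec using ([]; _∷_; here; there)
open import Function using (_∘_; id; const; case_of_)
open import Relation.Binary.PropositionalEquality hiding ([_])
open import Relation.Nullary
open import Relation.Nullary.Decidable using (_×-dec_; _⊎-dec_; ¬?)
open import Relation.Unary using (Decidable)
open +-*-Solver using (solve; _:+_; _:*_; _:^_; _:=_; con)

-- Lists as witnesses of upper and lower bounds for cardinalities

-- A cover may repeat entries and list non-members, so unions and images of covers need no
-- decidability.
Cover AtLeast : {A : Set} → ℕ → (A → Set) → Set
Cover   k P = Σ[ xs ∈ List _ ] length xs ≤ k × (∀ {x} → P x → x ∈ xs)
AtLeast k P = Σ[ xs ∈ List _ ] Unique xs × All P xs × k ≤ length xs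

lookup-injective : {A : Set} {xs : List A} → Unique xs →
  ∀ i j → lookup xs i ≡ lookup xs j → i ≡ j
lookup-injective (_ ∷ _) Fin.zero Fin.zero _ = refl
lookup-injective (x∉ ∷ _) Fin.zero (Fin.suc j) eq = ⊥-elim (All.lookup x∉ (∈-lookup j) eq)
lookup-injective (x∉ ∷ _) (Fin.suc i) Fin.zero eq = ⊥-elim (All.lookup x∉ (∈-lookup i) (sym eq))
lookup-injective (_ ∷ xs!) (Fin.suc i) (Fin.suc j) eq = cong Fin.suc (lookup-injective xs! i j eq)

allPairs-lookup : {A : Set} {S : A → A → Set} {xs : List A} {x y : A} → AllPairs S xs →
  x ∈ xs → y ∈ xs → x ≡ y ⊎ S x y ⊎ S y x
allPairs-lookup _          (here refl) (here refl) = inj₁ refl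
allPairs-lookup (Sx ∷ _)   (here refl) (there y∈)  = inj₂ (inj₁ (All.lookup Sx y∈))
allPairs-lookup (Sy ∷ _)   (there x∈)  (here refl) = inj₂ (inj₂ (All.lookup Sy x∈))
allPairs-lookup (_ ∷ Sxs)  (there x∈)  (there y∈)  = allPairs-lookup Sxs x∈ y∈

unique-remove : {A : Set} (xs : List A) {y : A} {ys : List A} → Unique (xs ++ y ∷ ys) → Unique (xs ++ ys)
unique-remove []       (_ ∷ ys!)  = ys!
unique-remove (x ∷ xs) (x∉ ∷ xs!) =
  All.++⁺ (All.++⁻ˡ xs x∉) (All.tail (All.++⁻ʳ xs x∉)) ∷ unique-remove xs xs!

unique-⊆⇒length≤ : {A : Set} {xs ys : List A} → Unique xs →
  (∀ {x} → x ∈ xs → x ∈ ys) → length xs ≤ length ys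
unique-⊆⇒length≤ {xs = xs} {ys} xs! sub = Fin.injective⇒≤ {f = position} position-injective
  where
  position : Fin (length xs) → Fin (length ys)
  position i = index (sub (∈-lookup {xs = xs} i))
  position-injective : ∀ {i j} → position i ≡ position j → i ≡ j
  position-injective {i} {j} eq = lookup-injective xs! i j
    (trans (lookup-index (sub (∈-lookup i)))
      (trans (cong (lookup ys) eq) (sym (lookup-index (sub (∈-lookup j))))))

atLeast-cover : {A : Set} {P : A → Set} {k l : ℕ} → AtLeast k P → Cover l P → k ≤ l
atLeast-cover (xs , xs! , Pxs , k≤) (ys , ≤l , P⊆) =
  ≤-trans k≤ (≤-trans (unique-⊆⇒length≤ xs! (P⊆ ∘ All.lookup Pxs)) ≤l)

cover-mono : {A : Set} {P Q : A → Set} {k l : ℕ} → k ≤ l → (∀ {x} → Q x → P x) →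
  Cover k P → Cover l Q
cover-mono k≤l Q⊆P (xs , ≤k , P⊆) = xs , ≤-trans ≤k k≤l , P⊆ ∘ Q⊆P

cover-empty : {A : Set} {P : A → Set} {k : ℕ} → (∀ x → ¬ P x) → Cover k P
cover-empty ¬P = [] , z≤n , λ {x} Px → ⊥-elim (¬P x Px)

cover-list : {A : Set} (xs : List A) → Cover (length xs) (_∈ xs)
cover-list xs = xs , ≤-refl , id

cover-∪ : {A : Set} {P Q : A → Set} {k l : ℕ} → Cover k P → Cover l Q →
  Cover (k + l) (λ x → P x ⊎ Q x)
cover-∪ (xs , ≤k , P⊆) (ys , ≤l , Q⊆) =
  xs ++ ys , ≤-trans (≤-reflexive (length-++ xs)) (+-mono-≤ ≤k ≤l) ,
  [ ∈-++⁺ˡ ∘ P⊆ , ∈-++⁺ʳ xs ∘ Q⊆ ]′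

length-concatMap-≤ : {A B : Set} {l : ℕ} (f : A → List B) (xs : List A) →
  (∀ {x} → x ∈ xs → length (f x) ≤ l) → length (concatMap f xs) ≤ length xs * l
length-concatMap-≤ f []       _  = z≤n
length-concatMap-≤ f (x ∷ xs) ≤l = ≤-trans (≤-reflexive (length-++ (f x)))
  (+-mono-≤ (≤l (here refl)) (length-concatMap-≤ f xs (≤l ∘ there)))

length-concatMap-≥ : {A B : Set} {l : ℕ} (f : A → List B) (xs : List A) →
  (∀ {x} → x ∈ xs → l ≤ length (f x)) → length xs * l ≤ length (concatMap f xs)
length-concatMap-≥ f []       _  = z≤n
length-concatMap-≥ f (x ∷ xs) l≤ = ≤-trans
  (+-mono-≤ (l≤ (here refl)) (length-concatMap-≥ f xs (l≤ ∘ there)))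
  (≤-reflexive (sym (length-++ (f x))))

cover-⋃ : {A B : Set} {P : A → Set} {R : A → B → Set} {k l : ℕ} →
  Cover k P → (∀ x → Cover l (R x)) → Cover (k * l) (λ y → ∃[ x ] P x × R x y)
cover-⋃ (xs , ≤k , P⊆) C =
  concatMap (proj₁ ∘ C) xs ,
  ≤-trans (length-concatMap-≤ (proj₁ ∘ C) xs (λ {x} _ → proj₁ (proj₂ (C x)))) (*-monoˡ-≤ _ ≤k) ,
  λ (x , Px , Rxy) → ∈-concatMap⁺ (proj₁ ∘ C) (lose (P⊆ Px) (proj₂ (proj₂ (C x)) Rxy))

cover-image : {A B : Set} {P : A → Set} {Q : B → Set} {k : ℕ} (f : A → B) →
  (∀ {y} → Q y → ∃[ x ] P x × y ≡ f x) → Cover k P → Cover k Q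
cover-image f Q⊆ (xs , ≤k , P⊆) = map f xs , ≤-trans (≤-reflexive (length-map f xs)) ≤k ,
  λ Qy → let _ , Px , eq = Q⊆ Qy in subst (_∈ map f xs) (sym eq) (∈-map⁺ f (P⊆ Px))

length-cartesianProduct : {A B : Set} (xs : List A) (ys : List B) →
  length (cartesianProduct xs ys) ≡ length xs * length ys
length-cartesianProduct []       ys = refl
length-cartesianProduct (x ∷ xs) ys = trans (length-++ (map (x ,_) ys))
  (cong₂ _+_ (length-map (x ,_) ys) (length-cartesianProduct xs ys))

cover-× : {A B : Set} {P : A → Set} {Q : B → Set} {k l : ℕ} → Cover k P → Cover l Q →
  Cover (k * l) (λ (x , y) → P x × Q y)
cover-× (xs , ≤k , P⊆) (ys , ≤l , Q⊆) = cartesianProduct xs ys ,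
  ≤-trans (≤-reflexive (length-cartesianProduct xs ys)) (*-mono-≤ ≤k ≤l) ,
  λ (Px , Qy) → ∈-cartesianProduct⁺ (P⊆ Px) (Q⊆ Qy)

-- `cover-⋃` asks for a cover of every fibre, while here only the fibres over `P` have one; `P?`
-- allows the others to be made empty.
cover-Σ : {A B : Set} {P : A → Set} {R : A → B → Set} {k l : ℕ} →
  Cover k P → (∀ x → P x → Cover l (R x)) → Decidable P →
  Cover (k * l) (λ (x , y) → P x × R x y)
cover-Σ {P = P} {R} {l = l} CP CR P? = cover-mono ≤-refl (λ (Px , Rxy) → _ , Px , refl , Px , Rxy)
  (cover-⋃ CP C)
  where
  C : ∀ x → Cover l (λ (x′ , y) → x′ ≡ x × P x × R x y)
  C x with P? x
  ... | yes Px = cover-image (x ,_) (λ { (refl , _ , Rxy) → _ , Rxy , refl }) (CR x Px)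
  ... | no ¬Px = cover-empty (λ _ (_ , Px , _) → ¬Px Px)

atLeast-mono : {A : Set} {P Q : A → Set} {k l : ℕ} → l ≤ k → (∀ {x} → P x → Q x) →
  AtLeast k P → AtLeast l Q
atLeast-mono l≤k P⊆Q (xs , xs! , Pxs , k≤) = xs , xs! , All.map P⊆Q Pxs , ≤-trans l≤k k≤

atLeast-nonempty : {A : Set} {P : A → Set} {k : ℕ} → 0 < k → AtLeast k P → ∃ P
atLeast-nonempty 0<k ([]     , _ , _       , k≤) = ⊥-elim (≤⇒≯ k≤ 0<k)
atLeast-nonempty _   (x ∷ _  , _ , Px ∷ _  , _ ) = x , Px

length-filter-split : {A : Set} {P : A → Set} (P? : Decidable P) (xs : List A) →
  length (filter P? xs) + length (filter (¬? ∘ P?) xs) ≡ length xs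
length-filter-split P? [] = refl
length-filter-split P? (x ∷ xs) with P? x
... | yes _ = cong suc (length-filter-split P? xs)
... | no  _ = trans (+-suc _ _) (cong suc (length-filter-split P? xs))

atLeast-∖ : {A : Set} {P Q : A → Set} {k l : ℕ} → Decidable Q →
  AtLeast k P → Cover l (λ x → P x × Q x) → AtLeast (k ∸ l) (λ x → P x × ¬ Q x)
atLeast-∖ {k = k} {l} Q? (xs , xs! , Pxs , k≤) C =
  ys , Unique.filter⁺ (¬? ∘ Q?) xs! ,
  All.tabulate (λ y∈ → let y∈xs , ¬Qy = ∈-filter⁻ (¬? ∘ Q?) {xs = xs} y∈ in All.lookup Pxs y∈xs , ¬Qy) ,
  (begin
    k ∸ l                              ≤⟨ ∸-mono k≤ removed ⟩
    length xs ∸ length zs              ≡⟨ cong (_∸ length zs) (sym (length-filter-split Q? xs)) ⟩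
    length zs + length ys ∸ length zs  ≡⟨ m+n∸m≡n (length zs) (length ys) ⟩
    length ys                          ∎)
  where
  open ≤-Reasoning
  zs = filter Q? xs
  ys = filter (¬? ∘ Q?) xs
  removed : length zs ≤ l
  removed = atLeast-cover
    (zs , Unique.filter⁺ Q? xs! ,
      All.tabulate (λ z∈ → let z∈xs , Qz = ∈-filter⁻ Q? {xs = xs} z∈ in All.lookup Pxs z∈xs , Qz) , ≤-refl)
    C

atLeast-image : {A B : Set} {P : A → Set} {Q : B → Set} {k : ℕ} (f : A → B) →
  (∀ {x y} → f x ≡ f y → x ≡ y) → (∀ {x} → P x → Q (f x)) → AtLeast k P → AtLeast k Q
atLeast-image f inj P⇒Q (xs , xs! , Pxs , k≤) =
  map f xs , Unique.map⁺ inj xs! , All.map⁺ (All.map P⇒Q Pxs) ,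
  ≤-trans k≤ (≤-reflexive (sym (length-map f xs)))

atLeast-Σ : {A B : Set} {P : A → Set} {R : A → B → Set} {k l : ℕ} →
  AtLeast k P → (∀ {x} → P x → AtLeast l (R x)) → AtLeast (k * l) (λ (x , y) → P x × R x y)
atLeast-Σ {A} {B} {P} {R} {k} {l} (xs , xs! , Pxs , k≤) ex =
  let ys , ys! , Rys , _ , ≤ys = go xs xs! Pxs in ys , ys! , Rys , ≤-trans (*-monoˡ-≤ l k≤) ≤ys
  where
  go : ∀ xs → Unique xs → All P xs → Σ[ ys ∈ List (A × B) ] Unique ys ×
    All (λ (x , y) → P x × R x y) ys × (∀ {y} → y ∈ ys → proj₁ y ∈ xs) × length xs * l ≤ length ys
  go [] _ _ = [] , [] , [] , (λ ()) , z≤n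
  go (x ∷ xs) (x∉ ∷ xs!) (Px ∷ Pxs) with ex Px | go xs xs! Pxs
  ... | zs , zs! , Rzs , l≤ | ys , ys! , Rys , fst∈ , ≤ys =
    map (x ,_) zs ++ ys ,
    Unique.++⁺ (Unique.map⁺ (λ { refl → refl }) zs!) ys! disjoint ,
    All.++⁺ (All.map⁺ (All.map (Px ,_) Rzs)) Rys ,
    fst∈′ ,
    ≤-trans (+-mono-≤ l≤ ≤ys)
      (≤-reflexive (sym (trans (length-++ (map (x ,_) zs)) (cong (_+ length ys) (length-map (x ,_) zs)))))
    where
    disjoint : ∀ {v} → v ∈ map (x ,_) zs × v ∈ ys → ⊥
    disjoint (v∈ , v∈ys) with ∈-map⁻ (x ,_) v∈
    ... | _ , _ , refl = All.lookup x∉ (fst∈ v∈ys) refl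
    fst∈′ : ∀ {y} → y ∈ map (x ,_) zs ++ ys → proj₁ y ∈ x ∷ xs
    fst∈′ y∈ with ∈-++⁻ (map (x ,_) zs) y∈
    ... | inj₂ y∈ys = there (fst∈ y∈ys)
    ... | inj₁ y∈zs with ∈-map⁻ (x ,_) y∈zs
    ...   | _ , _ , refl = here refl

-- Turns a refutation of many members into an upper bound, by filtering a finite universe.
cover? : {A : Set} {P : A → Set} {k : ℕ} (xs : List A) → Unique xs → (∀ {x} → P x → x ∈ xs) →
  Decidable P → ¬ AtLeast (suc k) P → Cover k P
cover? xs xs! P⊆ P? ¬many = filter P? xs ,
  ≮⇒≥ (λ many → ¬many (filter P? xs , Unique.filter⁺ P? xs! , All.all-filter P? xs , many)) ,
  λ Px → ∈-filter⁺ P? (P⊆ Px) Px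

-- For bounds obtained by comparing all members with one fixed member; if there is none, the empty
-- list suffices.
cover-by-member : {A : Set} {P : A → Set} {k : ℕ} (xs : List A) → (∀ {x} → P x → x ∈ xs) →
  Decidable P → (∀ p → P p → Cover k P) → Cover k P
cover-by-member xs P⊆ P? C with Any.any? P? xs
... | no ¬any = cover-empty (λ x Px → ¬any (lose (P⊆ Px) Px))
... | yes any = let p , _ , Pp = find any in C p Pp

-- A Moore bound with a conflict relation

-- Four cases for a path of length 4: its first or last interior vertex conflicts with the first or
-- last interior vertex of a fixed path. Each case leaves `s` choices for that vertex and
-- `s * s + s * s` for a path of length 3.
path-bound : ℕ → ℕ
path-bound s = (s * (s * s + s * s) + s * (s * s + s * s)) + (s * (s * s + s * s) + s * (s * s + s * s))

module EightCycles
  {U : Set} (W : List U)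
  (Adj : U → U → Set) (adj? : ∀ u v → Dec (Adj u v))
  (adj-sym : ∀ {u v} → Adj u v → Adj v u) (adj-∈ : ∀ {u v} → Adj u v → v ∈ W)
  (side : U → Bool) (adj-side : ∀ {u v} → Adj u v → side v ≡ not (side u))
  (_~_ : U → U → Set) (_~?_ : ∀ u v → Dec (u ~ v))
  (s : ℕ) (few-conflicts : ∀ u w → Cover s (λ v → Adj u v × v ~ w))
  -- At most three vertices are avoided at a time, each at a cost of `s` neighbours, which leaves
  -- `suc d`.
  (d : ℕ) (min-degree : ∀ {u v} → Adj u v → AtLeast (3 * s + suc d) (Adj v))
  where

  _≁_ : U → U → Set
  u ≁ v = ¬ u ~ v

  -- All arcs start on the side `b`. For two arcs it is enough that their sources or their targets
  -- do not conflict; sharing one end is allowed.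
  record Configuration : Set where
    field
      b        : Bool
      vertices : List U
      edges    : List (U × U)
      ≤8       : length vertices ≤ 8
      ≡8       : length edges ≡ 8
      arcs     : All (λ (u , v) → u ∈ vertices × v ∈ vertices × Adj u v × side u ≡ b) edges
      apart    : AllPairs (λ (u , v) (u′ , v′) → u′ ≁ u ⊎ v′ ≁ v) edges

  conflicts : ∀ u ws → Cover (length ws * s) (λ z → Adj u z × Any (z ~_) ws)
  conflicts u []       = cover-empty (λ _ ())
  conflicts u (w ∷ ws) = cover-mono ≤-refl
    (λ { (uz , here z~w) → inj₁ (uz , z~w) ; (uz , there z~) → inj₂ (uz , z~) })
    (cover-∪ (few-conflicts u w) (conflicts u ws))

  avoiding : ∀ {u v} → Adj u v → ∀ ws → length ws ≤ 3 →
    AtLeast (suc d) (λ z → Adj v z × All (z ≁_) ws)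
  avoiding {v = v} uv ws ≤3 = atLeast-mono enough (λ (vz , ¬any) → vz , All.¬Any⇒All¬ ws ¬any)
    (atLeast-∖ (λ z → Any.any? (z ~?_) ws) (min-degree uv) (conflicts v ws))
    where
    open ≤-Reasoning
    enough : suc d ≤ 3 * s + suc d ∸ length ws * s
    enough = begin
      suc d                           ≡⟨ sym (m+n∸m≡n (3 * s) (suc d)) ⟩
      3 * s + suc d ∸ 3 * s           ≤⟨ ∸-monoʳ-≤ (3 * s + suc d) (*-monoˡ-≤ s ≤3) ⟩
      3 * s + suc d ∸ length ws * s   ∎

  fresh : ∀ {u v} → Adj u v → ∀ ws → length ws ≤ 3 → ∃[ z ] Adj v z × All (z ≁_) ws
  fresh uv ws ≤3 = atLeast-nonempty z<s (avoiding uv ws ≤3)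

  same-side : ∀ {u v w} → Adj u v → Adj v w → side w ≡ side u
  same-side uv vw = trans (adj-side vw) (trans (cong not (adj-side uv)) (Bool.not-involutive _))

  pattern i₀ = here refl
  pattern i₁ = there i₀
  pattern i₂ = there i₁
  pattern i₃ = there i₂
  pattern i₄ = there i₃
  pattern i₅ = there i₄
  pattern i₆ = there i₅
  pattern i₇ = there i₆

  -- The paths are non-backtracking: vertices two steps apart do not conflict. For `Path₂` this
  -- concerns only the ends and is imposed separately. Since `_~_` is not assumed symmetric, the
  -- later vertex always stands on the left.
  Path₂ : U → U → U → Set
  Path₂ x y q = Adj x q × Adj q y

  Path₃ : U → U → U × U → Set
  Path₃ x y (q₁ , q₂) = Adj x q₁ × Adj q₁ q₂ × Adj q₂ y × q₂ ≁ x × y ≁ q₁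

  Path₄ : U → U → U × U × U → Set
  Path₄ x y (q₁ , q₂ , q₃) =
    Adj x q₁ × Adj q₁ q₂ × Adj q₂ q₃ × Adj q₃ y × q₂ ≁ x × q₃ ≁ q₁ × y ≁ q₂

  path₂? : ∀ x y → Decidable (Path₂ x y)
  path₂? x y q = adj? x q ×-dec adj? q y

  path₃? : ∀ x y → Decidable (Path₃ x y)
  path₃? x y (q₁ , q₂) =
    adj? x q₁ ×-dec adj? q₁ q₂ ×-dec adj? q₂ y ×-dec ¬? (q₂ ~? x) ×-dec ¬? (y ~? q₁)

  path₄? : ∀ x y → Decidable (Path₄ x y)
  path₄? x y (q₁ , q₂ , q₃) =
    adj? x q₁ ×-dec adj? q₁ q₂ ×-dec adj? q₂ q₃ ×-dec adj? q₃ y ×-dec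
    ¬? (q₂ ~? x) ×-dec ¬? (q₃ ~? q₁) ×-dec ¬? (y ~? q₂)

  -- The cycle `x p y q` has four arcs and a path `x z₁ z₂ z₃ z₄` supplies four more. The targets
  -- `p`, `q`, `z₁`, `z₃` are pairwise apart and each receives two arcs, so only sources with a
  -- common target must be apart. Hence no new vertex has more than three others to avoid.
  quadrilateral : ∀ {x y p q} → y ≁ x → Path₂ x y p → Path₂ x y q → q ≁ p → Configuration
  quadrilateral {x} {y} {p} {q} y≁x (xp , py) (xq , qy) q≁p
    with z₁ , xz₁ , z₁≁p ∷ z₁≁q ∷ [] ← fresh (adj-sym xp) (p ∷ q ∷ []) (s≤s (s≤s z≤n))
    with z₂ , z₁z₂ , z₂≁x ∷ [] ← fresh xz₁ (x ∷ []) (s≤s z≤n)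
    with z₃ , z₂z₃ , z₃≁p ∷ z₃≁q ∷ z₃≁z₁ ∷ [] ← fresh z₁z₂ (p ∷ q ∷ z₁ ∷ []) ≤-refl
    with z₄ , z₃z₄ , z₄≁z₂ ∷ [] ← fresh z₂z₃ (z₂ ∷ []) (s≤s z≤n) = record
    { b = side x
    ; vertices = x ∷ y ∷ z₂ ∷ z₄ ∷ p ∷ q ∷ z₁ ∷ z₃ ∷ []
    ; edges = (x , p) ∷ (y , p) ∷ (x , q) ∷ (y , q) ∷ (x , z₁) ∷ (z₂ , z₁) ∷ (z₂ , z₃) ∷ (z₄ , z₃) ∷ []
    ; ≤8 = ≤-refl
    ; ≡8 = refl
    ; arcs =
        (i₀ , i₄ , xp , refl) ∷ (i₁ , i₄ , adj-sym py , same-side xp py) ∷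
        (i₀ , i₅ , xq , refl) ∷ (i₁ , i₅ , adj-sym qy , same-side xp py) ∷
        (i₀ , i₆ , xz₁ , refl) ∷ (i₂ , i₆ , adj-sym z₁z₂ , same-side xz₁ z₁z₂) ∷
        (i₂ , i₇ , z₂z₃ , same-side xz₁ z₁z₂) ∷
        (i₃ , i₇ , adj-sym z₃z₄ , trans (same-side z₂z₃ z₃z₄) (same-side xz₁ z₁z₂)) ∷ []
    ; apart =
        (inj₁ y≁x ∷ inj₂ q≁p ∷ inj₂ q≁p ∷ inj₂ z₁≁p ∷ inj₂ z₁≁p ∷ inj₂ z₃≁p ∷ inj₂ z₃≁p ∷ []) ∷
        (inj₂ q≁p ∷ inj₂ q≁p ∷ inj₂ z₁≁p ∷ inj₂ z₁≁p ∷ inj₂ z₃≁p ∷ inj₂ z₃≁p ∷ []) ∷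
        (inj₁ y≁x ∷ inj₂ z₁≁q ∷ inj₂ z₁≁q ∷ inj₂ z₃≁q ∷ inj₂ z₃≁q ∷ []) ∷
        (inj₂ z₁≁q ∷ inj₂ z₁≁q ∷ inj₂ z₃≁q ∷ inj₂ z₃≁q ∷ []) ∷
        (inj₁ z₂≁x ∷ inj₂ z₃≁z₁ ∷ inj₂ z₃≁z₁ ∷ []) ∷
        (inj₂ z₃≁z₁ ∷ inj₂ z₃≁z₁ ∷ []) ∷
        (inj₁ z₄≁z₂ ∷ []) ∷
        [] ∷ []
    }

  -- The same scheme with a cycle of six arcs through `x` and `y` and a path `x z₁ z₂`. Here `y` is
  -- a target, because a path of length 3 changes sides.
  hexagon : ∀ {x y p₁ p₂ q₁ q₂} → Path₃ x y (p₁ , p₂) → Path₃ x y (q₁ , q₂) →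
    q₁ ≁ p₁ → q₂ ≁ p₂ → Configuration
  hexagon {x} {y} {p₁} {p₂} {q₁} {q₂}
    (xp₁ , p₁p₂ , p₂y , p₂≁x , y≁p₁) (xq₁ , q₁q₂ , q₂y , q₂≁x , y≁q₁) q₁≁p₁ q₂≁p₂
    with z₁ , xz₁ , z₁≁y ∷ z₁≁p₁ ∷ z₁≁q₁ ∷ [] ← fresh (adj-sym xp₁) (y ∷ p₁ ∷ q₁ ∷ []) ≤-refl
    with z₂ , z₁z₂ , z₂≁x ∷ [] ← fresh xz₁ (x ∷ []) (s≤s z≤n) = record
    { b = side x
    ; vertices = x ∷ p₂ ∷ q₂ ∷ z₂ ∷ y ∷ p₁ ∷ q₁ ∷ z₁ ∷ []
    ; edges = (x , p₁) ∷ (p₂ , p₁) ∷ (x , q₁) ∷ (q₂ , q₁) ∷ (p₂ , y) ∷ (q₂ , y) ∷ (x , z₁) ∷ (z₂ , z₁) ∷ []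
    ; ≤8 = ≤-refl
    ; ≡8 = refl
    ; arcs =
        (i₀ , i₅ , xp₁ , refl) ∷ (i₁ , i₅ , adj-sym p₁p₂ , same-side xp₁ p₁p₂) ∷
        (i₀ , i₆ , xq₁ , refl) ∷ (i₂ , i₆ , adj-sym q₁q₂ , same-side xq₁ q₁q₂) ∷
        (i₁ , i₄ , p₂y , same-side xp₁ p₁p₂) ∷ (i₂ , i₄ , q₂y , same-side xq₁ q₁q₂) ∷
        (i₀ , i₇ , xz₁ , refl) ∷ (i₃ , i₇ , adj-sym z₁z₂ , same-side xz₁ z₁z₂) ∷ []
    ; apart =
        (inj₁ p₂≁x ∷ inj₂ q₁≁p₁ ∷ inj₂ q₁≁p₁ ∷ inj₂ y≁p₁ ∷ inj₂ y≁p₁ ∷ inj₂ z₁≁p₁ ∷ inj₂ z₁≁p₁ ∷ []) ∷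
        (inj₂ q₁≁p₁ ∷ inj₂ q₁≁p₁ ∷ inj₂ y≁p₁ ∷ inj₂ y≁p₁ ∷ inj₂ z₁≁p₁ ∷ inj₂ z₁≁p₁ ∷ []) ∷
        (inj₁ q₂≁x ∷ inj₂ y≁q₁ ∷ inj₂ y≁q₁ ∷ inj₂ z₁≁q₁ ∷ inj₂ z₁≁q₁ ∷ []) ∷
        (inj₂ y≁q₁ ∷ inj₂ y≁q₁ ∷ inj₂ z₁≁q₁ ∷ inj₂ z₁≁q₁ ∷ []) ∷
        (inj₁ q₂≁p₂ ∷ inj₂ z₁≁y ∷ inj₂ z₁≁y ∷ []) ∷
        (inj₂ z₁≁y ∷ inj₂ z₁≁y ∷ []) ∷
        (inj₁ z₂≁x ∷ []) ∷
        [] ∷ []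
    }

  -- The middles p₂ and q₂ may share vertices, or even coincide: their neighbours keep the arcs apart.
  octagon : ∀ {x y p₁ p₂ p₃ q₁ q₂ q₃} → Path₄ x y (p₁ , p₂ , p₃) → Path₄ x y (q₁ , q₂ , q₃) →
    q₁ ≁ p₁ → q₁ ≁ p₃ → q₃ ≁ p₁ → q₃ ≁ p₃ → Configuration
  octagon {x} {y} {p₁} {p₂} {p₃} {q₁} {q₂} {q₃}
    (xp₁ , p₁p₂ , p₂p₃ , p₃y , p₂≁x , p₃≁p₁ , y≁p₂)
    (xq₁ , q₁q₂ , q₂q₃ , q₃y , q₂≁x , q₃≁q₁ , y≁q₂) q₁≁p₁ q₁≁p₃ q₃≁p₁ q₃≁p₃ = record
    { b = side x
    ; vertices = x ∷ y ∷ p₂ ∷ q₂ ∷ p₁ ∷ p₃ ∷ q₁ ∷ q₃ ∷ []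
    ; edges = (x , p₁) ∷ (p₂ , p₁) ∷ (p₂ , p₃) ∷ (y , p₃) ∷ (x , q₁) ∷ (q₂ , q₁) ∷ (q₂ , q₃) ∷ (y , q₃) ∷ []
    ; ≤8 = ≤-refl
    ; ≡8 = refl
    ; arcs =
        (i₀ , i₄ , xp₁ , refl) ∷ (i₂ , i₄ , adj-sym p₁p₂ , same-side xp₁ p₁p₂) ∷
        (i₂ , i₅ , p₂p₃ , same-side xp₁ p₁p₂) ∷ (i₁ , i₅ , adj-sym p₃y , y-side) ∷
        (i₀ , i₆ , xq₁ , refl) ∷ (i₃ , i₆ , adj-sym q₁q₂ , same-side xq₁ q₁q₂) ∷
        (i₃ , i₇ , q₂q₃ , same-side xq₁ q₁q₂) ∷ (i₁ , i₇ , adj-sym q₃y , y-side) ∷ []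
    ; apart =
        (inj₁ p₂≁x ∷ inj₂ p₃≁p₁ ∷ inj₂ p₃≁p₁ ∷ inj₂ q₁≁p₁ ∷ inj₂ q₁≁p₁ ∷ inj₂ q₃≁p₁ ∷ inj₂ q₃≁p₁ ∷ []) ∷
        (inj₂ p₃≁p₁ ∷ inj₂ p₃≁p₁ ∷ inj₂ q₁≁p₁ ∷ inj₂ q₁≁p₁ ∷ inj₂ q₃≁p₁ ∷ inj₂ q₃≁p₁ ∷ []) ∷
        (inj₁ y≁p₂ ∷ inj₂ q₁≁p₃ ∷ inj₂ q₁≁p₃ ∷ inj₂ q₃≁p₃ ∷ inj₂ q₃≁p₃ ∷ []) ∷
        (inj₂ q₁≁p₃ ∷ inj₂ q₁≁p₃ ∷ inj₂ q₃≁p₃ ∷ inj₂ q₃≁p₃ ∷ []) ∷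
        (inj₁ q₂≁x ∷ inj₂ q₃≁q₁ ∷ inj₂ q₃≁q₁ ∷ []) ∷
        (inj₂ q₃≁q₁ ∷ inj₂ q₃≁q₁ ∷ []) ∷
        (inj₁ y≁q₂ ∷ []) ∷
        [] ∷ []
    }
    where
    y-side : side y ≡ side x
    y-side = trans (same-side p₂p₃ p₃y) (same-side xp₁ p₁p₂)

  module _ (¬configuration : ¬ Configuration) where

    -- Two middles without a conflict would give a `quadrilateral`, so all middles conflict with a
    -- fixed one, and `few-conflicts` counts these.
    cover-path₂ : ∀ {x y} → y ≁ x → Cover s (Path₂ x y)
    cover-path₂ {x} {y} y≁x = cover-by-member W (λ (xq , _) → adj-∈ xq) (path₂? x y) λ p Pp →
      cover-mono ≤-refl (λ {q} Pq → proj₁ Pq , near Pp Pq) (few-conflicts x p)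
      where
      near : ∀ {p q} → Path₂ x y p → Path₂ x y q → q ~ p
      near {p} {q} Pp Pq with q ~? p
      ... | yes q~p = q~p
      ... | no  q≁p = ⊥-elim (¬configuration (quadrilateral y≁x Pp Pq q≁p))

    -- Compared with a fixed path, any other must start near `p₁` or end near `p₂`, or the two would
    -- form a `hexagon`. Either way a path of length 2 remains, and the conditions in `Path₃` keep
    -- its ends apart, as `cover-path₂` requires.
    cover-path₃ : ∀ {x y} → Cover (s * s + s * s) (Path₃ x y)
    cover-path₃ {x} {y} = cover-by-member (cartesianProduct W W)
      (λ (xq₁ , q₁q₂ , _) → ∈-cartesianProduct⁺ (adj-∈ xq₁) (adj-∈ q₁q₂)) (path₃? x y)
      λ { (p₁ , p₂) Pp → cover-mono ≤-refl (split Pp) (cover-∪ (near-start p₁) (near-end p₂)) }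
      where
      Near-start Near-end : U → U × U → Set
      Near-start p₁ (q₁ , q₂) = (Adj x q₁ × q₁ ~ p₁ × y ≁ q₁) × Path₂ q₁ y q₂
      Near-end   p₂ (q₁ , q₂) = (Adj y q₂ × q₂ ~ p₂ × q₂ ≁ x) × Path₂ x q₂ q₁
      near-start : ∀ p₁ → Cover (s * s) (Near-start p₁)
      near-start p₁ = cover-Σ
        (cover-mono ≤-refl (λ (xq₁ , q₁~p₁ , _) → xq₁ , q₁~p₁) (few-conflicts x p₁))
        (λ q₁ (_ , _ , y≁q₁) → cover-path₂ y≁q₁)
        (λ q₁ → adj? x q₁ ×-dec (q₁ ~? p₁) ×-dec ¬? (y ~? q₁))
      near-end : ∀ p₂ → Cover (s * s) (Near-end p₂)
      near-end p₂ = cover-image swap (λ near → _ , near , refl) (cover-Σ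
        (cover-mono ≤-refl (λ (yq₂ , q₂~p₂ , _) → yq₂ , q₂~p₂) (few-conflicts y p₂))
        (λ q₂ (_ , _ , q₂≁x) → cover-path₂ q₂≁x)
        (λ q₂ → adj? y q₂ ×-dec (q₂ ~? p₂) ×-dec ¬? (q₂ ~? x)))
      split : ∀ {p₁ p₂ q} → Path₃ x y (p₁ , p₂) → Path₃ x y q → Near-start p₁ q ⊎ Near-end p₂ q
      split {p₁} {p₂} {q₁ , q₂} Pp Pq@(xq₁ , q₁q₂ , q₂y , q₂≁x , y≁q₁) with q₁ ~? p₁ | q₂ ~? p₂
      ... | yes q₁~p₁ | _ = inj₁ ((xq₁ , q₁~p₁ , y≁q₁) , q₁q₂ , q₂y)
      ... | no  _ | yes q₂~p₂ = inj₂ ((adj-sym q₂y , q₂~p₂ , q₂≁x) , xq₁ , q₁q₂)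
      ... | no  q₁≁p₁ | no q₂≁p₂ = ⊥-elim (¬configuration (hexagon Pp Pq q₁≁p₁ q₂≁p₂))

    -- First and third interior vertices lie on one side, so an `octagon` needs all four pairs of
    -- them apart; a pair in conflict leaves a path of length 3 to count. The middle vertices are
    -- never compared.
    cover-path₄ : ∀ {x y} → Cover (path-bound s) (Path₄ x y)
    cover-path₄ {x} {y} = cover-by-member (cartesianProduct W (cartesianProduct W W))
      (λ (xq₁ , q₁q₂ , q₂q₃ , _) →
        ∈-cartesianProduct⁺ (adj-∈ xq₁) (∈-cartesianProduct⁺ (adj-∈ q₁q₂) (adj-∈ q₂q₃)))
      (path₄? x y)
      λ { (p₁ , p₂ , p₃) Pp → cover-mono ≤-refl (split Pp)
        (cover-∪ (cover-∪ (near-start p₁) (near-start p₃)) (cover-∪ (near-end p₁) (near-end p₃))) }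
      where
      Near-start Near-end : U → U × U × U → Set
      Near-start p (q₁ , q₂ , q₃) = (Adj x q₁ × q₁ ~ p) × Path₃ q₁ y (q₂ , q₃)
      Near-end   p (q₁ , q₂ , q₃) = (Adj y q₃ × q₃ ~ p) × Path₃ x q₃ (q₁ , q₂)
      near-start : ∀ p → Cover (s * (s * s + s * s)) (Near-start p)
      near-start p = cover-Σ (few-conflicts x p) (λ _ _ → cover-path₃) (λ q₁ → adj? x q₁ ×-dec (q₁ ~? p))
      near-end : ∀ p → Cover (s * (s * s + s * s)) (Near-end p)
      near-end p = cover-image (λ (q₃ , q₁ , q₂) → q₁ , q₂ , q₃) (λ near → _ , near , refl)
        (cover-Σ (few-conflicts y p) (λ _ _ → cover-path₃) (λ q₃ → adj? y q₃ ×-dec (q₃ ~? p)))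
      split : ∀ {p₁ p₂ p₃ q} → Path₄ x y (p₁ , p₂ , p₃) → Path₄ x y q →
        (Near-start p₁ q ⊎ Near-start p₃ q) ⊎ (Near-end p₁ q ⊎ Near-end p₃ q)
      split {p₁} {p₂} {p₃} {q₁ , q₂ , q₃} Pp
        Pq@(xq₁ , q₁q₂ , q₂q₃ , q₃y , q₂≁x , q₃≁q₁ , y≁q₂)
        with q₁ ~? p₁ | q₁ ~? p₃ | q₃ ~? p₁ | q₃ ~? p₃
      ... | yes q₁~p₁ | _ | _ | _ = inj₁ (inj₁ ((xq₁ , q₁~p₁) , q₁q₂ , q₂q₃ , q₃y , q₃≁q₁ , y≁q₂))
      ... | _ | yes q₁~p₃ | _ | _ = inj₁ (inj₂ ((xq₁ , q₁~p₃) , q₁q₂ , q₂q₃ , q₃y , q₃≁q₁ , y≁q₂))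
      ... | _ | _ | yes q₃~p₁ | _ = inj₂ (inj₁ ((adj-sym q₃y , q₃~p₁) , xq₁ , q₁q₂ , q₂q₃ , q₂≁x , q₃≁q₁))
      ... | _ | _ | _ | yes q₃~p₃ = inj₂ (inj₂ ((adj-sym q₃y , q₃~p₃) , xq₁ , q₁q₂ , q₂q₃ , q₂≁x , q₃≁q₁))
      ... | no q₁≁p₁ | no q₁≁p₃ | no q₃≁p₁ | no q₃≁p₃ =
        ⊥-elim (¬configuration (octagon Pp Pq q₁≁p₁ q₁≁p₃ q₃≁p₁ q₃≁p₃))

    -- Each of four steps from the start offers at least `suc d` choices, and at most `path-bound s`
    -- of the resulting paths share an end. The given arc leads into the start, as `min-degree`
    -- demands.
    moore-bound : ∀ {x y} → Adj x y → suc d * (suc d * (suc d * suc d)) ≤ length W * path-bound s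
    moore-bound {y = x} wx = atLeast-cover
      (atLeast-mono ≤-refl
        (λ { ((xq₁ , _) , (q₁q₂ , q₂≁x ∷ []) , (q₂q₃ , q₃≁q₁ ∷ []) , (q₃y , y≁q₂ ∷ [])) →
          _ , adj-∈ q₃y , _ , (xq₁ , q₁q₂ , q₂q₃ , q₃y , q₂≁x , q₃≁q₁ , y≁q₂) , refl })
        (atLeast-Σ (avoiding wx [] z≤n) λ {q₁} (xq₁ , _) →
          atLeast-Σ (avoiding xq₁ (x ∷ []) (s≤s z≤n)) λ {q₂} (q₁q₂ , _) →
          atLeast-Σ (avoiding q₁q₂ (q₁ ∷ []) (s≤s z≤n)) λ (q₂q₃ , _) →
          avoiding q₂q₃ (q₂ ∷ []) (s≤s z≤n)))
      (cover-⋃ (cover-list W) λ y →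
        cover-image (λ (q₁ , q₂ , q₃) → q₁ , q₂ , q₃ , y) id (cover-path₄ {x} {y}))

-- Subgraphs of large minimum degree

module DenseSubgraph {U : Set} (_≈_ : U → U → Set) (_≈?_ : ∀ u v → Dec (u ≈ v))
  (≈-sym : ∀ {u v} → u ≈ v → v ≈ u) where

  degree : U → List U → ℕ
  degree u L = length (filter (u ≈?_) L)

  -- On a list without repetitions this counts edges, each at the end that comes first.
  size : List U → ℕ
  size []      = 0
  size (u ∷ L) = degree u L + size L

  degree-++ : ∀ u L M → degree u (L ++ M) ≡ degree u L + degree u M
  degree-++ u L M = trans (cong length (filter-++ (u ≈?_) L M)) (length-++ (filter (u ≈?_) L))

  degree-singleton-sym : ∀ u v → degree u (v ∷ []) ≡ degree v (u ∷ [])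
  degree-singleton-sym u v with u ≈? v | v ≈? u
  ... | yes _   | yes _   = refl
  ... | no  _   | no  _   = refl
  ... | yes u≈v | no ¬v≈u = ⊥-elim (¬v≈u (≈-sym u≈v))
  ... | no ¬u≈v | yes v≈u = ⊥-elim (¬u≈v (≈-sym v≈u))

  degree-insert : ∀ u L v M → degree u (L ++ v ∷ M) ≡ degree u (v ∷ []) + degree u (L ++ M)
  degree-insert u L v M = begin
    degree u (L ++ v ∷ M)                              ≡⟨ degree-++ u L (v ∷ M) ⟩
    degree u L + degree u (v ∷ M)                      ≡⟨ cong (degree u L +_) (degree-++ u (v ∷ []) M) ⟩
    degree u L + (degree u (v ∷ []) + degree u M)      ≡⟨ x∙yz≈y∙xz +-commutativeSemigroup (degree u L) (degree u (v ∷ [])) (degree u M) ⟩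
    degree u (v ∷ []) + (degree u L + degree u M)      ≡⟨ cong (degree u (v ∷ []) +_) (sym (degree-++ u L M)) ⟩
    degree u (v ∷ []) + degree u (L ++ M)              ∎
    where open ≡-Reasoning

  -- The position of `v` does not matter because the relation is symmetric, so `dense-core` may
  -- delete a vertex from anywhere in the list.
  size-insert : ∀ L v M → size (L ++ v ∷ M) ≡ degree v (L ++ M) + size (L ++ M)
  size-insert []      v M = refl
  size-insert (u ∷ L) v M = begin
    degree u (L ++ v ∷ M) + size (L ++ v ∷ M)
      ≡⟨ cong₂ _+_ (degree-insert u L v M) (size-insert L v M) ⟩
    (degree u (v ∷ []) + degree u (L ++ M)) + (degree v (L ++ M) + size (L ++ M))
      ≡⟨ interchange +-commutativeSemigroup (degree u (v ∷ [])) _ (degree v (L ++ M)) _ ⟩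
    (degree u (v ∷ []) + degree v (L ++ M)) + (degree u (L ++ M) + size (L ++ M))
      ≡⟨ cong (λ k → (k + degree v (L ++ M)) + size (u ∷ L ++ M)) (degree-singleton-sym u v) ⟩
    (degree v (u ∷ []) + degree v (L ++ M)) + size (u ∷ L ++ M)
      ≡⟨ cong (_+ size (u ∷ L ++ M)) (sym (degree-++ v (u ∷ []) (L ++ M))) ⟩
    degree v (u ∷ L ++ M) + size (u ∷ L ++ M) ∎
    where open ≡-Reasoning

  record Core (D : ℕ) (L : List U) : Set where
    field
      core       : List U
      unique     : Unique core
      root       : ∃[ u ] u ∈ core
      min-degree : ∀ {u} → u ∈ core → D ≤ degree u core
      shorter    : length core ≤ length L

  -- Vertices of degree below `D` are deleted one by one. Each deletion loses at most `D` edges, so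
  -- `D * k < size L` persists; the empty list violates it, so the process stops at a core.
  dense-core : ∀ D k L → length L ≡ k → Unique L → D * k < size L → Core D L
  dense-core D zero    []      _  _  dense = ⊥-elim (n≮0 dense)
  dense-core D (suc k) (x ∷ L) eq L! dense with Any.any? (λ u → degree u (x ∷ L) <? D) (x ∷ L)
  ... | no ¬low = record
    { core = x ∷ L ; unique = L! ; root = x , here refl
    ; min-degree = λ u∈ → ≮⇒≥ (λ low → ¬low (lose u∈ low)) ; shorter = ≤-refl }
  ... | yes low with find low
  ...   | u , u∈ , deg<D with ∈-∃++ u∈
  ...     | before , after , split = record
    { core = Core.core rest ; unique = Core.unique rest ; root = Core.root rest
    ; min-degree = Core.min-degree rest
    ; shorter = ≤-trans (Core.shorter rest) (≤-trans (n≤1+n _) (≤-reflexive (sym len))) }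
    where
    L′ = before ++ after
    len : length (x ∷ L) ≡ suc (length L′)
    len = trans (cong length split) (trans (length-++ before)
      (trans (+-suc (length before) (length after)) (cong suc (sym (length-++ before)))))
    deg≤D : degree u L′ ≤ D
    deg≤D = begin
      degree u L′                        ≤⟨ m≤n+m _ (degree u (u ∷ [])) ⟩
      degree u (u ∷ []) + degree u L′    ≡⟨ sym (degree-insert u before u after) ⟩
      degree u (before ++ u ∷ after)     ≡⟨ cong (degree u) (sym split) ⟩
      degree u (x ∷ L)                   ≤⟨ <⇒≤ deg<D ⟩
      D                                  ∎
      where open ≤-Reasoning
    dense′ : D * k < size L′
    dense′ = +-cancelˡ-< D (D * k) (size L′) (begin-strict
      D + D * k                          ≡⟨ sym (*-suc D k) ⟩
      D * suc k                          <⟨ dense ⟩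
      size (x ∷ L)                       ≡⟨ cong size split ⟩
      size (before ++ u ∷ after)         ≡⟨ size-insert before u after ⟩
      degree u L′ + size L′              ≤⟨ +-monoˡ-≤ (size L′) deg≤D ⟩
      D + size L′                        ∎)
      where open ≤-Reasoning
    rest : Core D L′
    rest = dense-core D k L′ (suc-injective (trans (sym len) eq))
      (unique-remove before (subst Unique split L!)) dense′

  -- `Xs` precedes `Ys` in the list, so each arc is counted at its end in `Xs`; edges inside `Xs` or
  -- `Ys` only enlarge `size`.
  cover-arcs : ∀ Xs Ys → Cover (size (Xs ++ Ys)) (λ (u , v) → u ∈ Xs × v ∈ Ys × u ≈ v)
  cover-arcs []       Ys = cover-empty (λ _ ())
  cover-arcs (x ∷ Xs) Ys = cover-mono ≤-refl
    (λ { (here refl , v∈ , x≈v) → inj₁ (refl , v∈ , x≈v) ; (there u∈ , v∈ , u≈v) → inj₂ (u∈ , v∈ , u≈v) })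
    (cover-∪ arcs-from-x (cover-arcs Xs Ys))
    where
    arcs-from-x : Cover (degree x (Xs ++ Ys)) (λ (u , v) → u ≡ x × v ∈ Ys × x ≈ v)
    arcs-from-x = cover-image (x ,_)
      (λ { (refl , v∈ , x≈v) → _ , ∈-filter⁺ (x ≈?_) (∈-++⁺ʳ Xs v∈) x≈v , refl })
      (cover-list (filter (x ≈?_) (Xs ++ Ys)))

-- Counting repeated colours

elements : ∀ {n} → Subset n → List (Fin n)
elements []            = []
elements (inside  ∷ S) = zero ∷ map suc (elements S)
elements (outside ∷ S) = map suc (elements S)

length-elements : ∀ {n} (S : Subset n) → length (elements S) ≡ ∣ S ∣
length-elements []            = refl
length-elements (inside  ∷ S) = cong suc (trans (length-map suc (elements S)) (length-elements S))
length-elements (outside ∷ S) = trans (length-map suc (elements S)) (length-elements S)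

∈-elements : ∀ {n} {S : Subset n} {x} → x ∈ₛ S → x ∈ elements S
∈-elements {S = inside  ∷ _} here        = here refl
∈-elements {S = inside  ∷ _} (there x∈S) = there (∈-map⁺ suc (∈-elements x∈S))
∈-elements {S = outside ∷ _} (there x∈S) = ∈-map⁺ suc (∈-elements x∈S)

extend : ∀ {n} k (S : Subset n) → ∣ S ∣ ≤ k → k ≤ n → Σ[ T ∈ Subset n ] S ⊆ T × ∣ T ∣ ≡ k
extend {zero} zero [] _ _ = [] , id , refl
extend {suc n} zero S ≤k _ = S , id , n≤0⇒n≡0 ≤k
extend {suc n} (suc k) (inside ∷ S) (s≤s ≤k) (s≤s k≤n) =
  let T , S⊆T , eq = extend k S ≤k k≤n in inside ∷ T , s⊆s S⊆T , cong suc eq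
extend {suc n} (suc k) (outside ∷ S) ≤k (s≤s k≤n) with ∣ S ∣ ≤? k
... | yes ≤k′ = let T , S⊆T , eq = extend k S ≤k′ k≤n in
  inside ∷ T , (λ { (there x∈S) → there (S⊆T x∈S) }) , cong suc eq
... | no  ≰k = outside ∷ S , id , ≤-antisym ≤k (≰⇒> ≰k)

∣p∪q∣≤∣p∣+∣q∣ : ∀ {n} (p q : Subset n) → ∣ p ∪ q ∣ ≤ ∣ p ∣ + ∣ q ∣
∣p∪q∣≤∣p∣+∣q∣ []            []            = z≤n
∣p∪q∣≤∣p∣+∣q∣ (outside ∷ p) (outside ∷ q) = ∣p∪q∣≤∣p∣+∣q∣ p q
∣p∪q∣≤∣p∣+∣q∣ (outside ∷ p) (inside  ∷ q) = ≤-trans (s≤s (∣p∪q∣≤∣p∣+∣q∣ p q)) (≤-reflexive (sym (+-suc _ _)))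
∣p∪q∣≤∣p∣+∣q∣ (inside  ∷ p) (outside ∷ q) = s≤s (∣p∪q∣≤∣p∣+∣q∣ p q)
∣p∪q∣≤∣p∣+∣q∣ (inside  ∷ p) (inside  ∷ q) = s≤s (≤-trans (∣p∪q∣≤∣p∣+∣q∣ p q) (+-monoʳ-≤ ∣ p ∣ (n≤1+n _)))

subset-of-list : ∀ {n} (xs : List (Fin n)) →
  Σ[ S ∈ Subset n ] (∀ {x} → x ∈ xs → x ∈ₛ S) × ∣ S ∣ ≤ length xs
subset-of-list {n} [] = ∅ , (λ ()) , ≤-reflexive (∣⊥∣≡0 n)
subset-of-list (x ∷ xs) =
  let S , ∈S , ≤len = subset-of-list xs in
  ⁅ x ⁆ ∪ S ,
  (λ { (here refl) → p⊆p∪q S (x∈⁅x⁆ x) ; (there y∈) → q⊆p∪q ⁅ x ⁆ S (∈S y∈) }) ,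
  ≤-trans (∣p∪q∣≤∣p∣+∣q∣ ⁅ x ⁆ S) (+-mono-≤ (≤-reflexive (∣⁅x⁆∣≡1 x)) ≤len)

pairs : {A : Set} → List A → List (A × A)
pairs []       = []
pairs (x ∷ xs) = map (x ,_) xs ++ pairs xs

-- The binomial coefficient `k C 2`, in the shape in which `pairs` produces it.
triangular : ℕ → ℕ
triangular zero    = zero
triangular (suc k) = k + triangular k

length-pairs : {A : Set} (xs : List A) → length (pairs xs) ≡ triangular (length xs)
length-pairs []       = refl
length-pairs (x ∷ xs) = trans (length-++ (map (x ,_) xs))
  (cong₂ _+_ (length-map (x ,_) xs) (length-pairs xs))

∈-pairs : {A : Set} {xs : List A} {x y : A} → x ∈ xs → y ∈ xs → x ≢ y →
  (x , y) ∈ pairs xs ⊎ (y , x) ∈ pairs xs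
∈-pairs (here refl) (here refl) x≢y = ⊥-elim (x≢y refl)
∈-pairs {x = x} (here refl) (there y∈)  _   = inj₁ (∈-++⁺ˡ (∈-map⁺ (x ,_) y∈))
∈-pairs {y = y} (there x∈)  (here refl) _   = inj₂ (∈-++⁺ˡ (∈-map⁺ (y ,_) x∈))
∈-pairs {xs = z ∷ zs} (there x∈) (there y∈) x≢y with ∈-pairs x∈ y∈ x≢y
... | inj₁ p∈ = inj₁ (∈-++⁺ʳ (map (z ,_) zs) p∈)
... | inj₂ p∈ = inj₂ (∈-++⁺ʳ (map (z ,_) zs) p∈)

module Repetitions {n m : ℕ} (col : Colouring n m) {k ℓ : ℕ} (k≤n : k ≤ n) (good : Good col k ℓ)
  (side : Fin n → Bool) where

  V = Fin n

  colour : V × V → Fin m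
  colour (x , y) = χ col x y

  Arc : Bool → List V → V × V → Set
  Arc b vs (x , y) = (side x ≡ b × side y ≡ not b) × x ∈ vs × y ∈ vs

  open DecMembership {A = V × V} (≡-dec Fin._≟_ Fin._≟_) using (_∈?_)

  -- In a `k`-set containing `vs`, the pairs in `R` can be discarded without losing a colour, as
  -- each of their colours recurs outside `R`. So at most `triangular k ∸ length R` pairs would
  -- carry `ℓ` colours. Arcs lead from side `b` to the other side, hence distinct arcs are distinct
  -- edges.
  few-repetitions : ∀ b vs → length vs ≤ k → ∀ R → triangular k < length R + ℓ → Unique R →
    ¬ All (λ r → Arc b vs r × ∃[ r′ ] Arc b vs r′ × r′ ∉ R × colour r′ ≡ colour r) R
  few-repetitions b vs ≤k R many R! reps = <⇒≱ many (begin
    length R + ℓ                     ≤⟨ +-mono-≤ R≤dropped ℓ≤kept ⟩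
    length dropped + length kept     ≡⟨ length-filter-split redundant? P ⟩
    length P                         ≡⟨ length-pairs (elements T) ⟩
    triangular (length (elements T)) ≡⟨ cong triangular (trans (length-elements T) ∣T∣≡k) ⟩
    triangular k                     ∎)
    where
    open ≤-Reasoning
    S = proj₁ (subset-of-list vs)
    extended : Σ[ T ∈ Subset n ] S ⊆ T × ∣ T ∣ ≡ k
    extended = extend k S (≤-trans (proj₂ (proj₂ (subset-of-list vs))) ≤k) k≤n
    T = proj₁ extended
    ∣T∣≡k = proj₂ (proj₂ extended)
    vs⊆T : ∀ {x} → x ∈ vs → x ∈ elements T
    vs⊆T x∈ = ∈-elements (proj₁ (proj₂ extended) (proj₁ (proj₂ (subset-of-list vs)) x∈))
    P = pairs (elements T)
    Redundant : V × V → Set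
    Redundant p = p ∈ R ⊎ swap p ∈ R
    redundant? : Decidable Redundant
    redundant? p = (p ∈? R) ⊎-dec (swap p ∈? R)
    dropped = filter redundant? P
    kept    = filter (¬? ∘ redundant?) P

    arc-∈ : ∀ {x y} → Arc b vs (x , y) → (x , y) ∈ P ⊎ (y , x) ∈ P
    arc-∈ ((sx , sy) , x∈ , y∈) =
      ∈-pairs (vs⊆T x∈) (vs⊆T y∈) λ { refl → Bool.not-¬ sx sy }

    R-sided : ∀ {x y} → (x , y) ∈ R → side x ≡ b × side y ≡ not b
    R-sided r∈ = proj₁ (proj₁ (All.lookup reps r∈))

    -- `P` lists an edge in either direction; `orient` restores the one used in `R`, which places
    -- `R` inside the image of `dropped`.
    orient : V × V → V × V
    orient (x , y) with side x Bool.≟ b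
    ... | yes _ = x , y
    ... | no  _ = y , x

    orient-forward : ∀ {x y} → side x ≡ b → orient (x , y) ≡ (x , y)
    orient-forward {x} sx with side x Bool.≟ b
    ... | yes _  = refl
    ... | no  ¬p = ⊥-elim (¬p sx)

    orient-backward : ∀ {x y} → side y ≡ not b → orient (y , x) ≡ (x , y)
    orient-backward {y = y} sy with side y Bool.≟ b
    ... | yes p = ⊥-elim (Bool.not-¬ p sy)
    ... | no  _ = refl

    R≤dropped : length R ≤ length dropped
    R≤dropped = ≤-trans (unique-⊆⇒length≤ R! R⊆) (≤-reflexive (length-map orient dropped))
      where
      R⊆ : ∀ {r} → r ∈ R → r ∈ map orient dropped
      R⊆ {x , y} r∈ with arc-∈ (proj₁ (All.lookup reps r∈)) | R-sided r∈
      ... | inj₁ p∈ | sx , _ =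
        subst (_∈ map orient dropped) (orient-forward sx) (∈-map⁺ orient (∈-filter⁺ redundant? p∈ (inj₁ r∈)))
      ... | inj₂ p∈ | _ , sy =
        subst (_∈ map orient dropped) (orient-backward sy) (∈-map⁺ orient (∈-filter⁺ redundant? p∈ (inj₂ r∈)))

    kept-colour : ∀ {x y} → (x , y) ∈ kept → χ col x y ∈ map colour kept
    kept-colour = ∈-map⁺ colour

    representative : ∀ {x y} → (x , y) ∈ R → χ col x y ∈ map colour kept
    representative {x} {y} r∈ with All.lookup reps r∈
    ... | _ , (x′ , y′) , arc@((sx′ , sy′) , _) , r′∉ , same = subst (_∈ map colour kept) same r′-kept
      where
      -- The swapped arc starts on the wrong side to be in `R`, so the edge is kept in whichever
      -- direction `P` lists it.
      ¬swapped : (y′ , x′) ∉ R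
      ¬swapped r∈′ = Bool.not-¬ sx′ (proj₂ (R-sided r∈′))
      r′-kept : χ col x′ y′ ∈ map colour kept
      r′-kept with arc-∈ arc
      ... | inj₁ p∈ = kept-colour (∈-filter⁺ (¬? ∘ redundant?) p∈ [ r′∉ , ¬swapped ]′)
      ... | inj₂ p∈ = subst (_∈ map colour kept) (χ-sym col y′ x′)
        (kept-colour (∈-filter⁺ (¬? ∘ redundant?) p∈ [ ¬swapped , r′∉ ]′))

    all-colours : ∀ {x y} → (x , y) ∈ P → χ col x y ∈ map colour kept
    all-colours {x} {y} p∈ with redundant? (x , y)
    ... | no  ¬red      = kept-colour (∈-filter⁺ (¬? ∘ redundant?) p∈ ¬red)
    ... | yes (inj₁ r∈) = representative r∈
    ... | yes (inj₂ r∈) = subst (_∈ map colour kept) (χ-sym col y x) (representative r∈)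

    distinct = good T ∣T∣≡k
    edge = proj₁ distinct

    edge-colour : ∀ t → colour (edge t) ∈ map colour kept
    edge-colour t with edge t | proj₁ (proj₂ distinct) t
    ... | x , y | x∈ , y∈ , x≢y with ∈-pairs (∈-elements x∈) (∈-elements y∈) x≢y
    ...   | inj₁ p∈ = all-colours p∈
    ...   | inj₂ p∈ = subst (_∈ map colour kept) (χ-sym col y x) (all-colours p∈)

    ℓ≤kept : ℓ ≤ length kept
    ℓ≤kept = begin
      ℓ                                 ≡⟨ sym (length-tabulate (colour ∘ edge)) ⟩
      length (tabulate (colour ∘ edge)) ≤⟨ unique-⊆⇒length≤ (Unique.tabulate⁺ (proj₂ (proj₂ distinct)))
        (λ c∈ → let t , eq = ∈-tabulate⁻ c∈ in subst (_∈ map colour kept) (sym eq) (edge-colour t)) ⟩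
      length (map colour kept)          ≡⟨ length-map colour kept ⟩
      length kept                       ∎

-- A neighbour of u meets w in one of three positions, at one of three vertices, which leaves 16 choices
-- for each of its other two coordinates. Abstract, lest arithmetic unfold it into a unary numeral.
abstract
  conflict-bound : ℕ
  conflict-bound = 3 * (256 + (256 + 256))

  conflict-bound-≥ : 3 * (256 + (256 + 256)) ≤ conflict-bound
  conflict-bound-≥ = ≤-refl

-- The graph on triples and its forbidden configurations

module Triples {n m : ℕ} (col : Colouring n m) (24≤n : 24 ≤ n) (good : Good col 24 261)
  (side : Fin n → Bool) where

  open Repetitions col 24≤n good side

  -- Seventeen edges of one colour at `x` span 18 vertices and repeat a colour 16 times, one more
  -- than the 276 - 261 = 15 repetitions that 24 vertices allow. The edge to `y₀` is the one that
  -- represents the colour.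
  cover-star : ∀ x c → Cover 16 (λ y → side y ≡ not (side x) × χ col x y ≡ c)
  cover-star x c = cover? (allFin n) (Unique.allFin⁺ n) (λ {y} _ → ∈-allFin y)
    (λ y → (side y Bool.≟ not (side x)) ×-dec (χ col x y Fin.≟ c)) ¬many
    where
    ¬many : ¬ AtLeast 17 (λ y → side y ≡ not (side x) × χ col x y ≡ c)
    ¬many (y₀ ∷ ys , y₀∉ ∷ ys! , (sy₀ , χy₀) ∷ Pys , s≤s 16≤) =
      few-repetitions (side x) (x ∷ y₀ ∷ zs) (≤-trans (s≤s (s≤s (≤-reflexive ∣zs∣))) (m≤m+n 18 6))
        (map (x ,_) zs)
        (≤-reflexive (cong (_+ 261) (sym (trans (length-map (x ,_) zs) ∣zs∣))))
        (Unique.map⁺ (λ { refl → refl }) (Unique.take⁺ 16 ys!))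
        (All.map⁺ (All.tabulate λ z∈ →
          let sz , χz = All.lookup (All.take⁺ 16 Pys) z∈ in
          ((refl , sz) , here refl , there (there z∈)) ,
          (x , y₀) , ((refl , sy₀) , here refl , there (here refl)) , y₀-fresh , trans χy₀ (sym χz)))
      where
      zs = take 16 ys
      ∣zs∣ : length zs ≡ 16
      ∣zs∣ = trans (length-take 16 ys) (m≤n⇒m⊓n≡m 16≤)
      y₀-fresh : (x , y₀) ∉ map (x ,_) zs
      y₀-fresh p∈ with ∈-map⁻ (x ,_) p∈
      ... | _ , z∈ , refl = All.lookup (All.take⁺ 16 y₀∉) z∈ refl

  Triple = V × V × V

  coordinates : Triple → List V
  coordinates (a , b , c) = a ∷ b ∷ c ∷ []

  links : Triple → Triple → List (V × V)
  links (a , b , c) (a′ , b′ , c′) = (a , a′) ∷ (b , b′) ∷ (c , c′) ∷ []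

  tside : Triple → Bool
  tside (a , _) = side a

  Homogeneous : Triple → Set
  Homogeneous (a , b , c) = side b ≡ side a × side c ≡ side a

  -- Only the three edges must differ. Coordinates of a triple may coincide, which is harmless since
  -- 24 is just an upper bound for the number of vertices involved.
  _≈_ : Triple → Triple → Set
  u@(a , b , c) ≈ v@(a′ , b′ , c′) =
    Homogeneous u × Homogeneous v × tside v ≡ not (tside u) × Unique (links u v) ×
    χ col b b′ ≡ χ col a a′ × χ col c c′ ≡ χ col a a′

  _~_ : Triple → Triple → Set
  u ~ w = Any (_∈ coordinates w) (coordinates u)

  open DecMembership {A = V} Fin._≟_ using () renaming (_∈?_ to _∈V?_)

  _~?_ : ∀ u w → Dec (u ~ w)
  u ~? w = Any.any? (_∈V? coordinates w) (coordinates u)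

  homogeneous? : Decidable Homogeneous
  homogeneous? (a , b , c) = (side b Bool.≟ side a) ×-dec (side c Bool.≟ side a)

  _≈?_ : ∀ u v → Dec (u ≈ v)
  u@(a , b , c) ≈? v@(a′ , b′ , c′) =
    homogeneous? u ×-dec homogeneous? v ×-dec (tside v Bool.≟ not (tside u)) ×-dec
    DecUnique.unique? (≡-dec Fin._≟_ Fin._≟_) (links u v) ×-dec
    (χ col b b′ Fin.≟ χ col a a′) ×-dec (χ col c c′ Fin.≟ χ col a a′)

  swap-injective : {p q : V × V} → swap p ≡ swap q → p ≡ q
  swap-injective eq = cong swap eq

  ≈-sym : ∀ {u v} → u ≈ v → v ≈ u
  ≈-sym {a , b , c} {a′ , b′ , c′} (Hu , Hv , sv , distinct , χb , χc) =
    Hv , Hu , sym (trans (cong not sv) (Bool.not-involutive (side a))) , Unique.map⁺ swap-injective distinct ,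
    trans (χ-sym col b′ b) (trans χb (χ-sym col a a′)) ,
    trans (χ-sym col c′ c) (trans χc (χ-sym col a a′))

  -- Fixing one coordinate of `v` at `x` fixes the common colour of the three edges, after which
  -- `cover-star` bounds each of the other two coordinates.
  few-conflicts : ∀ u w → Cover conflict-bound (λ v → u ≈ v × v ~ w)
  few-conflicts u@(a , b , c) w = cover-mono conflict-bound-≥ split (cover-⋃ (cover-list (coordinates w)) λ x →
    cover-∪ (through-first x) (cover-∪ (through-second x) (through-third x)))
    where
    sides : ∀ {v} → u ≈ v → (let (a′ , b′ , c′) = v) →
      side a′ ≡ not (side a) × side b′ ≡ not (side b) × side c′ ≡ not (side c)
    sides ((sb , sc) , (sb′ , sc′) , sa′ , _) =
      sa′ , trans sb′ (trans sa′ (cong not (sym sb))) , trans sc′ (trans sa′ (cong not (sym sc)))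
    through-first through-second through-third : ∀ x → Cover 256 _
    through-first x = cover-image {Q = λ v → u ≈ v × proj₁ v ≡ x} (λ (b′ , c′) → x , b′ , c′)
      (λ { (uv@(_ , _ , _ , _ , χb , χc) , refl) →
        let _ , sb′ , sc′ = sides uv in _ , ((sb′ , χb) , (sc′ , χc)) , refl })
      (cover-× (cover-star b (χ col a x)) (cover-star c (χ col a x)))
    through-second x = cover-image {Q = λ v → u ≈ v × proj₁ (proj₂ v) ≡ x} (λ (a′ , c′) → a′ , x , c′)
      (λ { (uv@(_ , _ , _ , _ , χb , χc) , refl) →
        let sa′ , _ , sc′ = sides uv in _ , ((sa′ , sym χb) , (sc′ , trans χc (sym χb))) , refl })
      (cover-× (cover-star a (χ col b x)) (cover-star c (χ col b x)))
    through-third x = cover-image {Q = λ v → u ≈ v × proj₂ (proj₂ v) ≡ x} (λ (a′ , b′) → a′ , b′ , x)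
      (λ { (uv@(_ , _ , _ , _ , χb , χc) , refl) →
        let sa′ , sb′ , _ = sides uv in _ , ((sa′ , sym χc) , (sb′ , trans χb (sym χc))) , refl })
      (cover-× (cover-star a (χ col c x)) (cover-star b (χ col c x)))
    split : ∀ {v} → u ≈ v × v ~ w → ∃[ x ] x ∈ coordinates w ×
      (u ≈ v × proj₁ v ≡ x ⊎ u ≈ v × proj₁ (proj₂ v) ≡ x ⊎ u ≈ v × proj₂ (proj₂ v) ≡ x)
    split (uv , here x∈)                 = _ , x∈ , inj₁ (uv , refl)
    split (uv , there (here x∈))         = _ , x∈ , inj₂ (inj₁ (uv , refl))
    split (uv , there (there (here x∈))) = _ , x∈ , inj₂ (inj₂ (uv , refl))

  ∈-links : ∀ {u v x y} → (x , y) ∈ links u v → x ∈ coordinates u × y ∈ coordinates v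
  ∈-links (here refl)                 = here refl , here refl
  ∈-links (there (here refl))         = there (here refl) , there (here refl)
  ∈-links (there (there (here refl))) = there (there (here refl)) , there (there (here refl))

  links-disjoint : ∀ {u v u′ v′ p} → ¬ (u′ ~ u) ⊎ ¬ (v′ ~ v) → p ∈ links u v → p ∉ links u′ v′
  links-disjoint apart p∈ p∈′ with ∈-links p∈ | ∈-links p∈′
  ... | x∈ , y∈ | x∈′ , y∈′ = [ (λ u′≁u → u′≁u (lose x∈′ x∈)) , (λ v′≁v → v′≁v (lose y∈′ y∈)) ]′ apart

  -- The first edge of an adjacency is left out: it represents the colour.
  repeats : Triple × Triple → List (V × V)
  repeats ((_ , b , c) , (_ , b′ , c′)) = (b , b′) ∷ (c , c′) ∷ []

  -- Eight arcs give 16 repeated edges on at most 24 vertices, again one too many. Edges of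
  -- different arcs are distinct by `apart`, those of one arc by the definition of adjacency.
  no-eight-arcs : ∀ bool (vertices : List Triple) (edges : List (Triple × Triple)) →
    length vertices ≤ 8 → length edges ≡ 8 →
    All (λ (u , v) → u ∈ vertices × v ∈ vertices × u ≈ v × tside u ≡ bool) edges →
    ¬ AllPairs (λ (u , v) (u′ , v′) → ¬ (u′ ~ u) ⊎ ¬ (v′ ~ v)) edges
  no-eight-arcs s vertices edges ≤8 ≡8 arcs apart =
    few-repetitions s (concatMap coordinates vertices)
      (≤-trans (length-concatMap-≤ coordinates vertices (λ _ → ≤-refl)) (*-monoˡ-≤ 3 ≤8))
      R
      (+-monoˡ-≤ 261 (≤-trans (≤-reflexive (cong (_* 2) (sym ≡8)))
        (length-concatMap-≥ repeats edges (λ _ → ≤-refl))))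
      (Unique.concat⁺ (All.map⁺ (All.map (λ { (_ , _ , (_ , _ , _ , _ ∷ distinct , _) , _) → distinct }) arcs))
        (AllPairs.map⁺ (AllPairs.map repeats-disjoint apart)))
      (All.concat⁺ (All.map⁺ (All.tabulate repetition)))
    where
    R = concatMap repeats edges
    vs = concatMap coordinates vertices
    repeats-disjoint : ∀ {(u , v) (u′ , v′) : Triple × Triple} → ¬ (u′ ~ u) ⊎ ¬ (v′ ~ v) →
      ∀ {p} → ¬ (p ∈ repeats (u , v) × p ∈ repeats (u′ , v′))
    repeats-disjoint {u , v} {u′ , v′} ap (p∈ , p∈′) =
      links-disjoint {u} {v} {u′} {v′} ap (there p∈) (there p∈′)
    coordinate-∈ : ∀ {u x} → u ∈ vertices → x ∈ coordinates u → x ∈ vs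
    coordinate-∈ u∈ x∈ = ∈-concatMap⁺ coordinates (lose u∈ x∈)
    repetition : ∀ {uv} → uv ∈ edges →
      All (λ r → Arc s vs r × ∃[ r′ ] Arc s vs r′ × r′ ∉ R × colour r′ ≡ colour r) (repeats uv)
    repetition {u@(a , b , c) , v@(a′ , b′ , c′)} uv∈ with All.lookup arcs uv∈
    ... | u∈ , v∈ , ((sb , sc) , (sb′ , sc′) , sv , p∉ ∷ _ , χb , χc) , su =
      (((trans sb su , trans sb′ sa′) , coordinate-∈ u∈ (there (here refl)) , coordinate-∈ v∈ (there (here refl)))
        , (a , a′) , first , first-fresh , sym χb) ∷
      (((trans sc su , trans sc′ sa′) , coordinate-∈ u∈ (there (there (here refl))) ,
        coordinate-∈ v∈ (there (there (here refl)))) , (a , a′) , first , first-fresh , sym χc) ∷ []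
      where
      sa′ : side a′ ≡ not s
      sa′ = trans sv (cong not su)
      first : Arc s vs (a , a′)
      first = (su , sa′) , coordinate-∈ u∈ (here refl) , coordinate-∈ v∈ (here refl)
      -- An occurrence in `R` would come from the same arc, excluded by the distinct links, or from
      -- another one, excluded by `apart`, which compares arcs in list order only.
      first-fresh : (a , a′) ∉ R
      first-fresh p∈R with find (∈-concatMap⁻ repeats {xs = edges} p∈R)
      ... | (u′ , v′) , uv′∈ , p∈ with allPairs-lookup apart uv∈ uv′∈
      ...   | inj₁ refl      = All.lookup p∉ p∈ refl
      ...   | inj₂ (inj₁ ap) = links-disjoint {u} {v} ap (here refl) (there p∈)
      ...   | inj₂ (inj₂ ap) = links-disjoint {u′} {v′} {u} {v} ap (there p∈) (here refl)

  cube : List V → List Triple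
  cube X = cartesianProduct X (cartesianProduct X X)

  length-cube : ∀ X → length (cube X) ≡ length X * (length X * length X)
  length-cube X = trans (length-cartesianProduct X _) (cong (length X *_) (length-cartesianProduct X X))

  cube-unique : ∀ {X} → Unique X → Unique (cube X)
  cube-unique X! = Unique.cartesianProduct⁺ X! (Unique.cartesianProduct⁺ X! X!)

  -- Counting adjacencies between the two halves

  module Bipartite (X Y : List V) (X! : Unique X) (Y! : Unique Y) {h : ℕ}
    (∣X∣ : length X ≡ h) (∣Y∣ : length Y ≡ h)
    (X-side : All (λ x → side x ≡ true) X) (Y-side : All (λ y → side y ≡ false) Y) where

    E : List (V × V)
    E = cartesianProduct X Y

    colour-class : Fin m → List (V × V)
    colour-class c = filter (λ e → colour e Fin.≟ c) E

    Rare : ℕ → V × V → Set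
    Rare k e = length (colour-class (colour e)) ≤ k

    -- There are `m` colours, and each small class contributes at most `k` edges.
    cover-rare : ∀ k → Cover (m * k) (λ e → e ∈ E × Rare k e)
    cover-rare k = cover-mono (≤-reflexive (cong (_* k) (length-tabulate {n = m} id)))
      (λ {e} (e∈ , rare) → colour e , ∈-allFin (colour e) , rare , ∈-filter⁺ _ e∈ refl)
      (cover-⋃ {R = λ c e → length (colour-class c) ≤ k × e ∈ colour-class c} (cover-list (allFin m)) class)
      where
      class : ∀ c → Cover k (λ e → length (colour-class c) ≤ k × e ∈ colour-class c)
      class c with length (colour-class c) ≤? k
      ... | yes ≤k = colour-class c , ≤k , proj₂
      ... | no  ≰k = cover-empty (λ _ (≤k , _) → ≰k ≤k)

    popular : ∀ k → AtLeast (h * h ∸ m * k) (λ e → e ∈ E × ¬ Rare k e)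
    popular k = atLeast-∖ (λ e → length (colour-class (colour e)) ≤? k)
      (E , Unique.cartesianProduct⁺ X! Y! , All.tabulate id ,
        ≤-reflexive (sym (trans (length-cartesianProduct X Y) (cong₂ _*_ ∣X∣ ∣Y∣))))
      (cover-rare k)

    open DecMembership {A = V × V} (≡-dec Fin._≟_ Fin._≟_) using (_∈?_)

    -- A class that is not `Rare (suc g)` has at least `2 + g` edges, so `g` remain after avoiding
    -- up to two.
    same-colour : ∀ g e → ¬ Rare (suc g) e → ∀ es → length es ≤ 2 →
      AtLeast g (λ e′ → (e′ ∈ E × colour e′ ≡ colour e) × e′ ∉ es)
    same-colour g e ¬rare es ≤2 = atLeast-mono (∸-monoʳ-≤ (2 + g) ≤2) id
      (atLeast-∖ (_∈? es)
        (colour-class (colour e) , Unique.filter⁺ _ (Unique.cartesianProduct⁺ X! Y!) ,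
          All.tabulate (∈-filter⁻ _ {xs = E}) , ≰⇒> ¬rare)
        (cover-mono ≤-refl proj₂ (cover-list es)))

    transpose : (V × V) × (V × V) × (V × V) → Triple × Triple
    transpose ((x₁ , y₁) , (x₂ , y₂) , (x₃ , y₃)) = (x₁ , x₂ , x₃) , (y₁ , y₂ , y₃)

    -- An arc is an ordered choice of three distinct edges of one colour: a first edge in a large
    -- class, then `g` choices for each of the others.
    many-arcs : ∀ g → AtLeast ((h * h ∸ m * suc g) * (g * g)) (λ (u , v) → u ∈ cube X × v ∈ cube Y × u ≈ v)
    many-arcs g = atLeast-image transpose (λ { refl → refl }) arc
      (atLeast-Σ (popular (suc g)) λ {e₁} (_ , ¬rare) →
        atLeast-Σ (same-colour g e₁ ¬rare (e₁ ∷ []) (s≤s z≤n)) λ {e₂} _ →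
        same-colour g e₁ ¬rare (e₁ ∷ e₂ ∷ []) ≤-refl)
      where
      arc : ∀ {(e₁ , e₂ , e₃) : (V × V) × (V × V) × (V × V)} →
        (e₁ ∈ E × ¬ Rare (suc g) e₁) × ((e₂ ∈ E × colour e₂ ≡ colour e₁) × e₂ ∉ e₁ ∷ []) ×
          ((e₃ ∈ E × colour e₃ ≡ colour e₁) × e₃ ∉ e₁ ∷ e₂ ∷ []) →
        let u , v = transpose (e₁ , e₂ , e₃) in u ∈ cube X × v ∈ cube Y × u ≈ v
      arc ((e₁∈ , _) , ((e₂∈ , χ₂) , e₂∉) , ((e₃∈ , χ₃) , e₃∉))
        with ∈-cartesianProduct⁻ X Y e₁∈ | ∈-cartesianProduct⁻ X Y e₂∈ | ∈-cartesianProduct⁻ X Y e₃∈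
      ... | x₁ , y₁ | x₂ , y₂ | x₃ , y₃ =
        ∈-cartesianProduct⁺ x₁ (∈-cartesianProduct⁺ x₂ x₃) ,
        ∈-cartesianProduct⁺ y₁ (∈-cartesianProduct⁺ y₂ y₃) ,
        (trans (on-X x₂) (sym (on-X x₁)) , trans (on-X x₃) (sym (on-X x₁))) ,
        (trans (on-Y y₂) (sym (on-Y y₁)) , trans (on-Y y₃) (sym (on-Y y₁))) ,
        trans (on-Y y₁) (cong not (sym (on-X x₁))) ,
        ((λ eq → e₂∉ (here (sym eq))) ∷ (λ eq → e₃∉ (here (sym eq))) ∷ []) ∷
          ((λ eq → e₃∉ (there (here (sym eq)))) ∷ []) ∷ [] ∷ [] ,
        χ₂ , χ₃
        where
        on-X : ∀ {x} → x ∈ X → side x ≡ true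
        on-X = All.lookup X-side
        on-Y : ∀ {y} → y ∈ Y → side y ≡ false
        on-Y = All.lookup Y-side

    open DenseSubgraph _≈_ _≈?_ (λ {u} {v} → ≈-sym {u} {v})

    L : List Triple
    L = cube X ++ cube Y

    L! : Unique L
    L! = Unique.++⁺ (cube-unique X!) (cube-unique Y!) λ (u∈ , u∈′) →
      case trans (sym (All.lookup X-side (proj₁ (∈-cartesianProduct⁻ X _ u∈))))
                 (All.lookup Y-side (proj₁ (∈-cartesianProduct⁻ Y _ u∈′))) of λ ()

    ∣L∣ : length L ≡ h * (h * h) + h * (h * h)
    ∣L∣ = trans (length-++ (cube X)) (cong₂ _+_ (side-length X ∣X∣) (side-length Y ∣Y∣))
      where
      side-length : ∀ Z → length Z ≡ h → length (cube Z) ≡ h * (h * h)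
      side-length Z ∣Z∣ = trans (length-cube Z) (cong (λ k → k * (k * k)) ∣Z∣)

    -- Adjacency restricted to the core satisfies the hypotheses of `EightCycles`, and
    -- `no-eight-arcs` rules out its configurations.
    degree-bound : ∀ d → Core (3 * conflict-bound + suc d) L →
      suc d * (suc d * (suc d * suc d)) ≤ (h * (h * h) + h * (h * h)) * path-bound conflict-bound
    degree-bound d C = ≤-trans (Cycles.moore-bound no-configuration root-adj) (*-monoˡ-≤ (path-bound conflict-bound)
        (≤-trans shorter (≤-reflexive ∣L∣)))
      where
      open Core C
      open DecMembership {A = Triple} (≡-dec Fin._≟_ (≡-dec Fin._≟_ Fin._≟_)) using () renaming (_∈?_ to _∈ᵗ?_)
      Adj : Triple → Triple → Set
      Adj u v = u ∈ core × v ∈ core × u ≈ v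
      neighbours : ∀ {u} → u ∈ core → AtLeast (3 * conflict-bound + suc d) (Adj u)
      neighbours {u} u∈ = filter (u ≈?_) core , Unique.filter⁺ (u ≈?_) unique ,
        All.tabulate (λ v∈ → let v∈core , u≈v = ∈-filter⁻ (u ≈?_) {xs = core} v∈ in u∈ , v∈core , u≈v) ,
        min-degree u∈
      module Cycles = EightCycles core Adj
        (λ u v → (u ∈ᵗ? core) ×-dec (v ∈ᵗ? core) ×-dec (u ≈? v))
        (λ {u} {v} (u∈ , v∈ , u≈v) → v∈ , u∈ , ≈-sym {u} {v} u≈v) (proj₁ ∘ proj₂)
        tside (λ (_ , _ , _ , _ , opposite , _) → opposite)
        _~_ _~?_
        conflict-bound (λ u w → cover-mono ≤-refl (λ ((_ , _ , u≈v) , v~w) → u≈v , v~w) (few-conflicts u w))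
        d (λ (_ , v∈ , _) → neighbours v∈)
      no-configuration : ¬ Cycles.Configuration
      no-configuration config = no-eight-arcs b vertices edges ≤8 ≡8
        (All.map (λ (u∈ , v∈ , (_ , _ , u≈v) , s) → u∈ , v∈ , u≈v , s) arcs) apart
        where open Cycles.Configuration config
      root-adj : Adj (proj₁ root) _
      root-adj = proj₂ (atLeast-nonempty (≤-trans z<s (m≤n+m (suc d) (3 * conflict-bound))) (neighbours (proj₂ root)))

    -- More arcs than `D` times the number of triples would yield a core of minimum degree `D`,
    -- whose `degree-bound` contradicts the lower bound assumed for the fourth power of `suc d`.
    arcs-bound : ∀ D d g → D ≡ 3 * conflict-bound + suc d →
      (h * (h * h) + h * (h * h)) * path-bound conflict-bound < suc d * (suc d * (suc d * suc d)) →
      (h * h ∸ m * suc g) * (g * g) ≤ D * (h * (h * h) + h * (h * h))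
    arcs-bound D d g refl large = ≮⇒≥ λ dense → <⇒≱ large (degree-bound d
      (dense-core D (length L) L refl L! (subst (λ k → D * k < size L) (sym ∣L∣)
        (<-≤-trans dense (atLeast-cover (many-arcs g) (cover-arcs (cube X) (cube Y)))))))

-- Integer roots and the choice of parameters

integer-root : (f : ℕ → ℕ) → f 0 ≡ 0 → (∀ x → f x < f (suc x)) → ∀ M → ∃[ r ] f r ≤ M × M < f (suc r)
integer-root f f0 f< zero = 0 , ≤-reflexive f0 , subst (_< f 1) f0 (f< 0)
integer-root f f0 f< (suc M) with integer-root f f0 f< M
... | r , ≤M , M< with suc M <? f (suc r)
...   | yes M+1< = r , m≤n⇒m≤1+n ≤M , M+1<
...   | no  M+1≮ = suc r , ≮⇒≥ M+1≮ , ≤-<-trans M< (f< (suc r))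

square-< : ∀ x → x * x < suc x * suc x
square-< x = *-mono-< (n<1+n x) (n<1+n x)

fourth-< : ∀ x → x * (x * (x * x)) < suc x * (suc x * (suc x * suc x))
fourth-< x = *-mono-< (n<1+n x) (*-mono-< (n<1+n x) (square-< x))

root-pos : ∀ {M r} → 0 < M → M < suc r * suc r → 0 < r
root-pos {r = zero}  0<M M<1 = ⊥-elim (<⇒≱ M<1 0<M)
root-pos {r = suc r} _   _   = z<s

-- With d ≈ (2 K h³)^(1/4), D = 3 s + d and g ≈ (4 D h)^(1/2), the bound fails unless h² < 2 m (g + 2).
exponent-arithmetic : ∀ s K h m → 0 < h →
  (∀ d g → (h * (h * h) + h * (h * h)) * K < suc d * (suc d * (suc d * suc d)) →
    (h * h ∸ m * suc g) * (g * g) ≤ (3 * s + suc d) * (h * (h * h) + h * (h * h))) →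
  h ^ 9 ≤ (144 * (3 * s + 2)) ^ 4 * (2 * suc K) * m ^ 8
-- The extra factor `h ^ 3` makes the left side a fourth power, so that `h³≤` applies; on the right
-- it reappears through `d⁴≤`.
exponent-arithmetic s K h m 0<h bound = *-cancelˡ-≤ (h ^ 3) (begin
  h ^ 3 * h ^ 9                             ≡⟨ solve 1 (λ h → h :^ 3 :* h :^ 9 := (h :^ 3) :^ 4) refl h ⟩
  (h ^ 3) ^ 4                               ≤⟨ ^-monoˡ-≤ 4 h³≤ ⟩
  (A * (m ^ 2 * d)) ^ 4
    ≡⟨ solve 3 (λ A m d → (A :* (m :^ 2 :* d)) :^ 4 := A :^ 4 :* m :^ 8 :* (d :* (d :* (d :* d)))) refl A m d ⟩
  A ^ 4 * m ^ 8 * (d * (d * (d * d)))       ≤⟨ *-monoʳ-≤ (A ^ 4 * m ^ 8) d⁴≤ ⟩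
  A ^ 4 * m ^ 8 * (N * suc K)
    ≡⟨ solve 4 (λ a b h k → a :* b :* ((h :* (h :* h) :+ h :* (h :* h)) :* k) := h :^ 3 :* (a :* (con 2 :* k) :* b)) refl (A ^ 4) (m ^ 8) h (suc K) ⟩
  h ^ 3 * (A ^ 4 * (2 * suc K) * m ^ 8)     ∎)
  where
  open ≤-Reasoning
  instance
    h≢0 : NonZero h
    h≢0 = >-nonZero 0<h
    h²≢0 : NonZero (h * h)
    h²≢0 = m*n≢0 h h
    h³≢0 : NonZero (h ^ 3)
    h³≢0 = m^n≢0 h 3
  A = 144 * (3 * s + 2)
  N = h * (h * h) + h * (h * h)

  -- `suc K` in place of `K` keeps the radicand positive, so that `d>0` holds even for `K` zero.
  d-root = integer-root (λ x → x * (x * (x * x))) refl fourth-< (N * suc K)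
  d = proj₁ d-root
  d⁴≤ = proj₁ (proj₂ d-root)
  <d⁴ = proj₂ (proj₂ d-root)
  N>0 : 0 < N * suc K
  N>0 = *-mono-< (≤-trans (*-mono-< 0<h (*-mono-< 0<h 0<h)) (m≤m+n _ _)) z<s
  d>0 : 0 < d
  d>0 with d | <d⁴
  ... | zero  | N<1 = ⊥-elim (<⇒≱ N<1 N>0)
  ... | suc _ | _   = z<s
  D = 3 * s + suc d
  D≤ : D ≤ (3 * s + 2) * d
  D≤ = begin
    3 * s + suc d               ≤⟨ +-mono-≤ (m≤m*n (3 * s) d {{>-nonZero d>0}}) (+-monoˡ-≤ d d>0) ⟩
    3 * s * d + (d + d)
      ≡⟨ solve 2 (λ s d → con 3 :* s :* d :+ (d :+ d) := (con 3 :* s :+ con 2) :* d) refl s d ⟩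
    (3 * s + 2) * d             ∎

  -- The threshold comes from `2 * (D * N)`, which equals `h * h * (4 * D * h)`.
  g-root = integer-root (λ x → x * x) refl square-< (4 * D * h)
  g = proj₁ g-root
  g²≤ = proj₁ (proj₂ g-root)
  <g² = proj₂ (proj₂ g-root)
  g>0 : 0 < g
  g>0 = root-pos (*-mono-< {0} (*-mono-< {0} {4} z<s (≤-trans z<s (m≤n+m (suc d) (3 * s)))) 0<h) <g²

  colours-large : h * h < 2 * (m * suc (suc g))
  -- Otherwise at most half of the `h * h` edges are rare, and `bound` at `suc g` forces the square
  -- of `suc g` down to `4 * D * h`.
  colours-large = ≰⇒> λ few → <⇒≱ <g² (*-cancelˡ-≤ (h * h) (begin
    h * h * (suc g * suc g)
      ≤⟨ *-monoˡ-≤ (suc g * suc g) (half {b = m * suc (suc g)} few) ⟩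
    2 * (h * h ∸ m * suc (suc g)) * (suc g * suc g) ≡⟨ *-assoc 2 (h * h ∸ m * suc (suc g)) (suc g * suc g) ⟩
    2 * ((h * h ∸ m * suc (suc g)) * (suc g * suc g))
      ≤⟨ *-monoʳ-≤ 2 (bound d (suc g) (≤-<-trans (*-monoʳ-≤ N (n≤1+n K)) <d⁴)) ⟩
    2 * (D * N)
      ≡⟨ solve 2 (λ D h → con 2 :* (D :* (h :* (h :* h) :+ h :* (h :* h))) := h :* h :* (con 4 :* D :* h)) refl D h ⟩
    h * h * (4 * D * h)                             ∎))
    where
    half : ∀ {a b} → 2 * b ≤ a → a ≤ 2 * (a ∸ b)
    half {a} {b} 2b≤a = begin
      a                     ≡⟨ sym (m+n∸m≡n a a) ⟩
      a + a ∸ a             ≤⟨ ∸-monoʳ-≤ (a + a) 2b≤a ⟩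
      a + a ∸ 2 * b         ≡⟨ cong (λ k → k ∸ 2 * b) (cong (a +_) (sym (+-identityʳ a))) ⟩
      2 * a ∸ 2 * b         ≡⟨ sym (*-distribˡ-∸ 2 a b) ⟩
      2 * (a ∸ b)           ∎

  h²≤ : h * h ≤ 6 * (m * g)
  h²≤ = begin
    h * h                       ≤⟨ <⇒≤ colours-large ⟩
    2 * (m * (2 + g))           ≤⟨ *-monoʳ-≤ 2 (*-monoʳ-≤ m (+-monoˡ-≤ g (+-mono-≤ g>0 g>0))) ⟩
    2 * (m * (g + g + g))
      ≡⟨ solve 2 (λ m g → con 2 :* (m :* (g :+ g :+ g)) := con 6 :* (m :* g)) refl m g ⟩
    6 * (m * g)                 ∎

  -- Squaring `h²≤` makes `g²≤` applicable; the constant 144 is 36 times 4.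
  h³≤ : h ^ 3 ≤ A * (m ^ 2 * d)
  h³≤ = *-cancelˡ-≤ h (begin
    h * h ^ 3                           ≡⟨ solve 1 (λ h → h :* h :^ 3 := (h :* h) :* (h :* h)) refl h ⟩
    (h * h) * (h * h)                   ≤⟨ *-mono-≤ h²≤ h²≤ ⟩
    6 * (m * g) * (6 * (m * g))
      ≡⟨ solve 2 (λ m g → con 6 :* (m :* g) :* (con 6 :* (m :* g)) := con 36 :* m :^ 2 :* (g :* g)) refl m g ⟩
    36 * m ^ 2 * (g * g)                ≤⟨ *-monoʳ-≤ (36 * m ^ 2) g²≤ ⟩
    36 * m ^ 2 * (4 * D * h)
      ≡⟨ solve 3 (λ m D h → con 36 :* m :^ 2 :* (con 4 :* D :* h) := h :* (con 144 :* m :^ 2 :* D)) refl m D h ⟩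
    h * (144 * m ^ 2 * D)               ≤⟨ *-monoʳ-≤ h (*-monoʳ-≤ (144 * m ^ 2) D≤) ⟩
    h * (144 * m ^ 2 * ((3 * s + 2) * d))
      ≡⟨ cong (h *_) (solve 3 (λ m a d → con 144 :* m :^ 2 :* (a :* d) := con 144 :* a :* (m :^ 2 :* d)) refl m (3 * s + 2) d) ⟩
    h * (A * (m ^ 2 * d))               ∎)

-- Halving the vertex set and conclusion

halves-bound : ∀ {h r m} → h ≤ r → 24 ≤ h + r → (col : Colouring (h + r) m) → Good col 24 261 → ∀ d g →
  (h * (h * h) + h * (h * h)) * path-bound conflict-bound < suc d * (suc d * (suc d * suc d)) →
  (h * h ∸ m * suc g) * (g * g) ≤ (3 * conflict-bound + suc d) * (h * (h * h) + h * (h * h))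
halves-bound {h} {r} h≤r 24≤n col good d g =
  Triples.Bipartite.arcs-bound col 24≤n good in-left?
    -- If `r` is `suc h`, one vertex on the right is left out, so that both halves have `h`
    -- vertices.
    (map (_↑ˡ r) (allFin h)) (map (h ↑ʳ_) (take h (allFin r)))
    (Unique.map⁺ (Fin.↑ˡ-injective r _ _) (Unique.allFin⁺ h))
    (Unique.map⁺ (Fin.↑ʳ-injective h _ _) (Unique.take⁺ h (Unique.allFin⁺ r)))
    (trans (length-map (_↑ˡ r) (allFin h)) (length-tabulate {n = h} id))
    (trans (length-map (h ↑ʳ_) (take h (allFin r)))
      (trans (length-take h (allFin r)) (trans (cong (h ⊓_) (length-tabulate {n = r} id)) (m≤n⇒m⊓n≡m h≤r))))
    (All.map⁺ (All.tabulate λ {i} _ → cong [ const true , const false ]′ (Fin.splitAt-↑ˡ h i r)))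
    (All.map⁺ (All.tabulate λ {j} _ → cong [ const true , const false ]′ (Fin.splitAt-↑ʳ h r j)))
    _ d g refl
  where
  in-left? : Fin (h + r) → Bool
  in-left? v = [ const true , const false ]′ (splitAt h v)

bipartite-constant : ℕ
bipartite-constant = (144 * (3 * conflict-bound + 2)) ^ 4 * (2 * suc (path-bound conflict-bound))

halves-theorem : ∀ {n h r m} → h + r ≡ n → h ≤ r → r ≤ suc h → 24 ≤ n → (col : Colouring n m) →
  Good col 24 261 →
  n ^ 9 ≤ suc (3 ^ 9 * bipartite-constant) * m ^ 8
halves-theorem {h = zero} refl _ r≤1 24≤n _ _ = ⊥-elim (<⇒≱ (m≤m+n 2 22) (≤-trans 24≤n r≤1))
halves-theorem {n} {h@(suc _)} {r} {m} refl h≤r r≤ 24≤n col good = begin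
  n ^ 9                        ≤⟨ ^-monoˡ-≤ 9 n≤3h ⟩
  (3 * h) ^ 9                  ≡⟨ solve 1 (λ h → (con 3 :* h) :^ 9 := con 3 :^ 9 :* h :^ 9) refl h ⟩
  3 ^ 9 * h ^ 9
    ≤⟨ *-monoʳ-≤ (3 ^ 9) (exponent-arithmetic conflict-bound (path-bound conflict-bound) h m z<s
                                    (halves-bound h≤r 24≤n col good)) ⟩
  3 ^ 9 * (bipartite-constant * m ^ 8)          ≡⟨ sym (*-assoc (3 ^ 9) bipartite-constant (m ^ 8)) ⟩
  3 ^ 9 * bipartite-constant * m ^ 8            ≤⟨ *-monoˡ-≤ (m ^ 8) (n≤1+n (3 ^ 9 * bipartite-constant)) ⟩
  suc (3 ^ 9 * bipartite-constant) * m ^ 8      ∎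
  where
  open ≤-Reasoning
  n≤3h : h + r ≤ 3 * h
  -- Here `r` is at most `suc h`, and `suc h` is at most `h + h` because `h` is positive.
  n≤3h = +-monoʳ-≤ h (≤-trans r≤ (≤-trans (+-monoˡ-≤ h (s≤s z≤n)) (+-monoʳ-≤ h (m≤m+n h 0))))

-- The exponent 9/8 is cleared by taking eighth powers, so the implied constant is the inverse
-- eighth root of `c`.
theorem1p3 : Σ ℕ λ c → Σ ℕ λ N → (c > 0) ×
    (∀ n → n ≥ N → ∀ m → (col : Colouring n m) →
    Good col 24 ((24 C 2) ∸ 15) → n ^ 9 ≤ c * m ^ 8)
-- The number `(24 C 2) ∸ 15` evaluates to 261, and from 24 vertices on every small vertex set
-- extends to one of size 24. The successor makes the constant visibly positive.
theorem1p3 = suc (3 ^ 9 * bipartite-constant) , 24 , z<s , λ n 24≤n m col good →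
  halves-theorem (⌊n/2⌋+⌈n/2⌉≡n n) (⌊n/2⌋≤⌈n/2⌉ n) (⌊n/2⌋-mono (n≤1+n (suc n))) 24≤n col good
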